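{- For every $n\ge1$, the set $\{(\mathrm{st}_1(\tau),\mathrm{st}_2(\tau)) : \tau\in\mathrm{SPCT}((2^n))\}\subseteq\mathfrak{S}_n\times\mathfrak{S}_n$ is in bijection with the set of labeled binary trees on $n$ nodes with no right ascents. Consequently its cardinality is $(n+1)^{n-1}$.
   Context: $\mathrm{SPCT}((2^n))$ is the set of fillings $\tau$ of the $n\times2$ array ($n$ rows of length 2) with the distinct integers $1,\dots,2n$ such that each row decreases from left to right and (triple condition) whenever $i<r$ and the entries in cells $(i,1),(i,2),(r,2)$ are $a,b,c$, $a\ge c$ implies $b>c$. For $j\in\{1,2\}$, $\mathrm{st}_j(\tau)\in\mathfrak{S}_n$ is the standardization of the word formed by column $j$ read top to bottom, where the standardization of a word $w_1\cdots w_n$ of distinct integers is the unique $\pi\in\mathfrak{S}_n$ with $\pi(i)>\pi(k)$ iff $w_i>w_k$. A labeled binary tree on $n$ nodes is a rooted plane tree in which each node has at most one left child and at most one right child, nodes labeled distinctly by $[n]$. A right ascent is an edge from a node $p$ to its right child $q$ with $\mathrm{label}(p)<\mathrm{label}(q)$. -}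

module Defs where

open import Data.Nat as ℕ using (ℕ; zero; suc; _+_; _*_)
open import Data.Fin as Fin using (Fin; _<_; _≤_)
open import Data.Vec using (Vec; lookup)
open import Data.Product using (Σ; _×_; ∃; _,_)
open import Data.Empty using (⊥)
open import Data.Unit using (⊤)
open import Data.Irrelevant using (Irrelevant)
open import Relation.Binary.PropositionalEquality using (_≡_)
open import Function.Bundles using (_⇔_)

-- Columns: column 1 = Fin.zero, column 2 = Fin.suc Fin.zero.
-- Values 1..2n are encoded (order-preservingly) as Fin (2 * n).
col₁ col₂ : Fin 2
col₁ = Fin.zero
col₂ = Fin.suc Fin.zero

-- A filling of the n×2 array with distinct integers from [2n]
-- (rows indexed by Fin n, top to bottom).
Filling : ℕ → Set
Filling n = Fin n → Fin 2 → Fin (2 * n)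

Distinct : ∀ {n} → Filling n → Set
Distinct {n} τ = ∀ i j k l → τ i j ≡ τ k l → (i ≡ k) × (j ≡ l)

RowsDecreasing : ∀ {n} → Filling n → Set
RowsDecreasing {n} τ = ∀ i → τ i col₂ < τ i col₁

TripleCondition : ∀ {n} → Filling n → Set
TripleCondition {n} τ =
  ∀ i r → i < r → τ r col₂ ≤ τ i col₁ → τ r col₂ < τ i col₂

record IsSPCT {n : ℕ} (τ : Filling n) : Set where
  field
    distinct : Distinct τ
    rowsDec  : RowsDecreasing τ
    triple   : TripleCondition τ

SPCT : ℕ → Set
SPCT n = Σ (Filling n) IsSPCT

IsPerm : ∀ {n} → Vec (Fin n) n → Set
IsPerm {n} π = ∀ i k → lookup π i ≡ lookup π k → i ≡ k

IsStandardization : ∀ {n m} → (Fin n → Fin m) → Vec (Fin n) n → Set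
IsStandardization {n} w π =
  IsPerm π × (∀ i k → (lookup π k < lookup π i) ⇔ (w k < w i))

column : ∀ {n} → Filling n → Fin 2 → Fin n → Fin (2 * n)
column τ j i = τ i j

-- The set {(st₁ τ, st₂ τ) : τ ∈ SPCT((2^n))} ⊆ S_n × S_n.
-- Membership is a proposition (wrapped irrelevantly), so elements are just pairs.
StPairs : ℕ → Set
StPairs n = Σ (Vec (Fin n) n × Vec (Fin n) n) λ where
  (π₁ , π₂) → Irrelevant (∃ λ (τ : SPCT n) → let (f , _) = τ in
      IsStandardization (column f col₁) π₁ × IsStandardization (column f col₂) π₂)

data BTree (A : Set) : Set where
  leaf : BTree A
  node : BTree A → A → BTree A → BTree A

size : ∀ {A} → BTree A → ℕ
size leaf = 0
size (node l _ r) = suc (size l + size r)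

data _∈T_ {A : Set} (x : A) : BTree A → Set where
  here  : ∀ {l r} → x ∈T node l x r
  left  : ∀ {l y r} → x ∈T l → x ∈T node l y r
  right : ∀ {l y r} → x ∈T r → x ∈T node l y r

-- a labeled binary tree on n nodes: n nodes, labels distinct elements of [n]
-- (n nodes with distinct labels from Fin n means every label used exactly once)
data DistinctLabels {A : Set} : BTree A → Set where
  leaf : DistinctLabels leaf
  node : ∀ {l x r} → DistinctLabels l → DistinctLabels r →
         (x ∈T l → ⊥) → (x ∈T r → ⊥) →
         (∀ {y} → y ∈T l → y ∈T r → ⊥) →
         DistinctLabels (node l x r)

NoRightAscent : ∀ {n} → BTree (Fin n) → Set
NoRightAscent leaf = ⊤
NoRightAscent (node l x leaf) = NoRightAscent l
NoRightAscent (node l x (node rl y rr)) =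
  (x < y → ⊥) × NoRightAscent l × NoRightAscent (node rl y rr)

record IsLabeledBTNoRA (n : ℕ) (t : BTree (Fin n)) : Set where
  field
    sizeN    : size t ≡ n
    distinct : DistinctLabels t
    noRA     : NoRightAscent t

LabeledBTNoRightAscent : ℕ → Set
LabeledBTNoRightAscent n = Σ (BTree (Fin n)) λ t → Irrelevant (IsLabeledBTNoRA n t)

{-# OPTIONS --safe #-}
module Submission where

-- Both sets are in bijection with the parking functions f : [n] → {0, …, n - 1}, and there are
-- (n+1)^(n-1) of these because every class of maps [n] → ℤ/(n+1) modulo rotation contains exactly
-- one parking function.
--
-- Pairs: rank the rows by decreasing entry, with rank tm i in column 2 and pos i in column 1. A
-- pair comes from a filling iff i < r and tm r < tm i force pos m < pos i for every m with
-- tm m ≤ tm r. Then f i = #{m ∣ tm m < tm i, pos m < pos i} is a parking function. Letting the rows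
-- park in order with preferred spots f recovers tm as the outcome, and, tm being known, f is a
-- Lehmer code of pos.
--
-- Trees: a tree with no right ascent is a rooted forest with unordered sibling sets. Number the
-- sibling sets (the empty ones included) in preorder and let f x be the number of the set
-- containing x. Reading the sibling sets backwards rebuilds the tree on a stack, and the stack
-- never runs empty exactly when f is a parking function.

open import Defs
open import Data.Nat
open import Data.Nat.DivMod using (_%_; [m+kn]%n≡m%n; m<n⇒m%n≡m)
open import Data.Nat.Induction using (<-wellFounded)
open import Data.Nat.Properties
open import Data.Nat.Tactic.RingSolver using (solve-∀)
open import Algebra.Properties.CommutativeSemigroup +-commutativeSemigroup using (interchange)
open import Data.Empty using (⊥; ⊥-elim)
open import Data.Fin as Fin
  using (Fin; toℕ; fromℕ<; opposite; combine; remQuot; funToFin; finToFun)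
import Data.Fin.Properties as Fin
open import Data.Irrelevant using () renaming ([_] to irr)
open import Data.List.Base as List
  using (List; []; _∷_; _++_; length; concat; concatMap; foldr; filter; drop; tabulate)
open import Data.List.Properties as List
  using (++-assoc; ++-identityʳ; length-++; concat-++; ∷-injective)
open import Data.List.Membership.Propositional using (_∈_; _∉_)
open import Data.List.Membership.Propositional.Properties
  using (∈-++⁺ˡ; ∈-++⁺ʳ; ∈-++⁻; ∈-filter⁺; ∈-filter⁻; ∈-tabulate⁺)
open import Data.List.Relation.Binary.Disjoint.Propositional using (Disjoint)
open import Data.List.Relation.Binary.Permutation.Propositional
  using (_↭_; ↭-sym; ↭-trans; ↭-reflexive; prep; ↭⇒↭ₛ)
open import Data.List.Relation.Binary.Permutation.Propositional.Properties
  using (↭-length; shifts) renaming (++⁺ to ↭-++⁺)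
open import Data.List.Relation.Binary.Permutation.Setoid.Properties using (Unique-resp-↭)
open import Data.List.Relation.Unary.All as All using (All; []; _∷_)
import Data.List.Relation.Unary.All.Properties as All
open import Data.List.Relation.Unary.AllPairs as AllPairs using (AllPairs; []; _∷_)
import Data.List.Relation.Unary.AllPairs.Properties as AllPairs
open import Data.List.Relation.Unary.Any using (here; there; any?)
open import Data.List.Relation.Unary.Unique.Propositional using (Unique)
import Data.List.Relation.Unary.Unique.Propositional.Properties as Unique
open import Data.Product using (∃; ∃₂; _×_; _,_; proj₁; proj₂; uncurry)
import Data.Product.Properties as Product
open import Data.Sum using (_⊎_; inj₁; inj₂; [_,_])
open import Data.Unit using (⊤; tt)
open import Data.Vec as Vec using (Vec; lookup)
import Data.Vec.Properties as Vec
open import Data.Vec.Functional using (updateAt)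
open import Data.Vec.Functional.Properties using (updateAt-updates; updateAt-minimal)
open import Function.Base
open import Function.Bundles using (_↔_; mk⇔; mk↔ₛ′; Equivalence)
open import Function.Construct.Composition using (_↔-∘_)
open import Function.Construct.Symmetry using (↔-sym)
open import Induction.WellFounded using (Acc; acc)
open import Relation.Binary.Definitions using (DecidableEquality; tri<; tri≈; tri>)
open import Relation.Binary.PropositionalEquality hiding ([_])
open import Relation.Nullary
open import Relation.Nullary.Decidable using (decidable-stable; map′)
open import Relation.Unary using (Decidable)

-- Counting

-- Compatibility is what makes `tm` a parking outcome. If `i < r` and `r` has the smaller spot, then
-- each of the `tm r + 1` rows `m` with `tm m ≤ tm r` counts towards `f i`, so `f i > tm r`: row `i`
-- was not allowed to take that spot. Existence is proved spot by spot rather than car by car,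
-- because a Lehmer code describes insertion in the order of spots; both rankings and the
-- compatibility invariant then grow together. Uniqueness of `tm`, in contrast, goes row by row. The
-- exponent `n - 1` arises because a class modulo rotation is given by the differences to the first
-- value. Parking functions are only compared pointwise, and the two bijections meet in the finite
-- set of these difference codes.

indicator : {A : Set} → Dec A → ℕ
indicator (yes _) = 1
indicator (no _)  = 0

count : ∀ {n} {P : Fin n → Set} → Decidable P → ℕ
count {zero}  P? = 0
count {suc n} P? = indicator (P? Fin.zero) + count (P? ∘ Fin.suc)

indicator-modular : ∀ {P Q R S : Set} (P? : Dec P) (Q? : Dec Q) (R? : Dec R) (S? : Dec S) →
  (P ⊎ Q → R ⊎ S) → (P → Q → R × S) →
  indicator P? + indicator Q? ≤ indicator R? + indicator S?
indicator-modular (no _) (no _) _ _ _ _ = z≤n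
indicator-modular (yes p) (yes q) R? S? _ both with R? | S?
... | yes _ | yes _ = ≤-refl
... | no ¬r | _     = contradiction (proj₁ (both p q)) ¬r
... | yes _ | no ¬s = contradiction (proj₂ (both p q)) ¬s
indicator-modular (yes p) (no _) R? S? one _ with R? | S?
... | yes _ | _     = s≤s z≤n
... | no _  | yes _ = ≤-refl
... | no ¬r | no ¬s = contradiction (one (inj₁ p)) [ ¬r , ¬s ]
indicator-modular (no _) (yes q) R? S? one _ with R? | S?
... | yes _ | _     = s≤s z≤n
... | no _  | yes _ = ≤-refl
... | no ¬r | no ¬s = contradiction (one (inj₂ q)) [ ¬r , ¬s ]

-- The source of most counting inequalities below, checked pointwise on indicators. With `⊤?` or
-- `⊥?` in some of the four places it yields monotonicity and the bounds for covering and for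
-- disjoint sets.
count-modular : ∀ {n} {P Q R S : Fin n → Set}
  (P? : Decidable P) (Q? : Decidable Q) (R? : Decidable R) (S? : Decidable S) →
  (∀ i → P i ⊎ Q i → R i ⊎ S i) → (∀ i → P i → Q i → R i × S i) →
  count P? + count Q? ≤ count R? + count S?
count-modular {zero}  P? Q? R? S? one both = z≤n
count-modular {suc n} P? Q? R? S? one both = begin
  (indicator (P? z) + count (P? ∘ Fin.suc)) + (indicator (Q? z) + count (Q? ∘ Fin.suc))
    ≡⟨ interchange (indicator (P? z)) _ _ _ ⟩
  (indicator (P? z) + indicator (Q? z)) + (count (P? ∘ Fin.suc) + count (Q? ∘ Fin.suc))
    ≤⟨ +-mono-≤ (indicator-modular (P? z) (Q? z) (R? z) (S? z) (one z) (both z))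
                (count-modular (P? ∘ Fin.suc) (Q? ∘ Fin.suc) (R? ∘ Fin.suc) (S? ∘ Fin.suc)
                  (one ∘ Fin.suc) (both ∘ Fin.suc)) ⟩
  (indicator (R? z) + indicator (S? z)) + (count (R? ∘ Fin.suc) + count (S? ∘ Fin.suc))
    ≡⟨ interchange (indicator (R? z)) _ _ _ ⟩
  (indicator (R? z) + count (R? ∘ Fin.suc)) + (indicator (S? z) + count (S? ∘ Fin.suc)) ∎
  where
  open ≤-Reasoning
  z = Fin.zero

⊤? : ∀ {n} → Decidable {A = Fin n} (λ _ → ⊤)
⊤? _ = yes tt

⊥? : ∀ {n} → Decidable {A = Fin n} (λ _ → ⊥)
⊥? _ = no λ ()

count-⊤ : ∀ n → count {n} ⊤? ≡ n
count-⊤ zero    = refl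
count-⊤ (suc n) = cong suc (count-⊤ n)

count-⊥ : ∀ n → count {n} ⊥? ≡ 0
count-⊥ zero    = refl
count-⊥ (suc n) = count-⊥ n

+-count-⊥ : ∀ n m → m + count {n} ⊥? ≡ m
+-count-⊥ n m = trans (cong (m +_) (count-⊥ n)) (+-identityʳ m)

module _ {n} {P Q : Fin n → Set} (P? : Decidable P) (Q? : Decidable Q) where

  count-mono : (∀ i → P i → Q i) → count P? ≤ count Q?
  count-mono P⊆Q = subst₂ _≤_ (+-count-⊥ n (count P?)) (+-count-⊥ n (count Q?))
    (count-modular P? ⊥? Q? ⊥? (λ i → [ inj₁ ∘ P⊆Q i , (λ ()) ]) (λ _ _ ()))

  count-cover : (∀ i → P i ⊎ Q i) → n ≤ count P? + count Q?
  count-cover P∪Q = subst (_≤ count P? + count Q?)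
    (trans (+-count-⊥ n _) (count-⊤ n))
    (count-modular ⊤? ⊥? P? Q? (λ i _ → P∪Q i) (λ _ _ ()))

  count-disjoint : (∀ i → P i → Q i → ⊥) → count P? + count Q? ≤ n
  count-disjoint P∩Q = subst (count P? + count Q? ≤_)
    (trans (+-count-⊥ n _) (count-⊤ n))
    (count-modular P? Q? ⊤? ⊥? (λ _ _ → inj₁ tt) (λ i p q → ⊥-elim (P∩Q i p q)))

module _ {n} {P Q : Fin n → Set} (P? : Decidable P) (Q? : Decidable Q) where

  count-cong : (∀ i → P i → Q i) → (∀ i → Q i → P i) → count P? ≡ count Q?
  count-cong P⊆Q Q⊆P = ≤-antisym (count-mono P? Q? P⊆Q) (count-mono Q? P? Q⊆P)

  count<⇒∃ : count P? < count Q? → ∃ λ i → Q i × ¬ P i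
  count<⇒∃ lt with Fin.any? (λ i → Q? i ×-dec ¬? (P? i))
  ... | yes found = found
  ... | no ¬found = contradiction lt (≤⇒≯
    (count-mono Q? P? λ i q → decidable-stable (P? i) λ ¬p → ¬found (i , q , ¬p)))

count-pos : ∀ {n} {P : Fin n → Set} (P? : Decidable P) {i} → P i → 1 ≤ count P?
count-pos P? {Fin.zero} p with P? Fin.zero
... | yes _ = s≤s z≤n
... | no ¬p = contradiction p ¬p
count-pos P? {Fin.suc i} p =
  ≤-trans (count-pos (P? ∘ Fin.suc) p) (m≤n+m _ (indicator (P? Fin.zero)))

count-subsingleton : ∀ {n} {P : Fin n → Set} (P? : Decidable P) →
  (∀ {i j} → P i → P j → i ≡ j) → count P? ≤ 1
count-subsingleton {zero} P? _ = z≤n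
count-subsingleton {suc n} P? unique with P? Fin.zero
... | yes p = s≤s (≤-trans
  (count-mono (P? ∘ Fin.suc) ⊥? (λ i q → case unique p q of λ ())) (≤-reflexive (count-⊥ n)))
... | no _ = count-subsingleton (P? ∘ Fin.suc) λ p q → Fin.suc-injective (unique p q)

count-strict : ∀ {n} {P Q : Fin n → Set} (P? : Decidable P) (Q? : Decidable Q) →
  (∀ i → P i → Q i) → ∀ {j} → Q j → ¬ P j → count P? < count Q?
count-strict {n} {P} {Q} P? Q? P⊆Q {j} q ¬p = begin
  1 + count P?                    ≡⟨ +-comm 1 _ ⟩
  count P? + 1                    ≤⟨ +-monoʳ-≤ _ (count-pos (Fin._≟ j) refl) ⟩
  count P? + count (Fin._≟ j)     ≤⟨ count-modular P? (Fin._≟ j) Q? ⊥?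
                                       (λ i → [ inj₁ ∘ P⊆Q i , (λ where refl → inj₁ q) ])
                                       (λ where _ p refl → contradiction p ¬p) ⟩
  count Q? + count {n} ⊥?         ≡⟨ +-count-⊥ n _ ⟩
  count Q?                        ∎
  where open ≤-Reasoning

module _ {n t} {P : Fin n → Set} (P? : Decidable P) (key : Fin n → ℕ)
  (key-injective : ∀ {i j} → P i → P j → key i ≡ key j → i ≡ j)
  (key<t : ∀ {i} → P i → key i < t) (t≤count : t ≤ count P?) where

  private
    below : ∀ v → Decidable (λ i → P i × key i < v)
    below v i = P? i ×-dec (key i <? v)

    count-below-suc : ∀ v → count (below (suc v)) ≤ suc (count (below v))
    count-below-suc v = begin
      count (below (suc v))                       ≡⟨ +-count-⊥ n _ ⟨
      count (below (suc v)) + count {n} ⊥?        ≤⟨ count-modular (below (suc v)) ⊥? at (below v)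
                                                       (λ i → [ split i , (λ ()) ]) (λ _ _ ()) ⟩
      count at + count (below v)
        ≤⟨ +-monoˡ-≤ _ (count-subsingleton at
             λ (p , eq) (q , eq′) → key-injective p q (trans eq (sym eq′))) ⟩
      suc (count (below v))                       ∎
      where
      open ≤-Reasoning
      at : Decidable (λ i → P i × key i ≡ v)
      at i = P? i ×-dec (key i ≟ v)
      split : ∀ i → P i × key i < suc v → (P i × key i ≡ v) ⊎ (P i × key i < v)
      split i (p , s≤s le) with m≤n⇒m<n∨m≡n le
      ... | inj₁ lt = inj₂ (p , lt)
      ... | inj₂ eq = inj₁ (p , eq)

    count-below≤ : ∀ v → count (below v) ≤ v
    count-below≤ zero = ≤-trans (count-mono (below 0) ⊥? λ _ ()) (≤-reflexive (count-⊥ n))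
    count-below≤ (suc v) = ≤-trans (count-below-suc v) (s≤s (count-below≤ v))

    count-below+ : ∀ d v → count (below (d + v)) ≤ d + count (below v)
    count-below+ zero    v = ≤-refl
    count-below+ (suc d) v = ≤-trans (count-below-suc (d + v)) (s≤s (count-below+ d v))

  -- Raising `v` by one adds at most one key, and the `t` steps together must reach at least `t`
  -- elements, so every step adds exactly one. The keys are thus a bijection onto the numbers below
  -- `t`.
  count-below : ∀ {v} → v ≤ t → count (below v) ≡ v
  count-below {v} v≤t = ≤-antisym (count-below≤ v) (+-cancelˡ-≤ (t ∸ v) _ _ (begin
    (t ∸ v) + v                ≡⟨ m∸n+n≡m v≤t ⟩
    t                          ≤⟨ t≤count ⟩
    count P?                   ≤⟨ count-mono P? (below t) (λ _ p → p , key<t p) ⟩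
    count (below t)            ≡⟨ cong (count ∘ below) (m∸n+n≡m v≤t) ⟨
    count (below (t ∸ v + v))  ≤⟨ count-below+ (t ∸ v) v ⟩
    t ∸ v + count (below v)    ∎))
    where open ≤-Reasoning

-- Parking functions modulo rotation

-- The usual condition ‘at least j values lie below j’, stated for the complementary set.
IsParking : ∀ {n} → (Fin n → ℕ) → Set
IsParking {n} f = ∀ {j} → j ≤ n → count (λ i → j ≤? f i) + j ≤ n

parking-< : ∀ {n} (f : Fin n → ℕ) → IsParking f → ∀ i → f i < n
parking-< {n} f pf i = ≰⇒> λ n≤fi → 1+n≰n (≤-trans
  (+-monoˡ-≤ n (count-pos (λ i → n ≤? f i) {i} n≤fi)) (pf ≤-refl))

module _ (N : ℕ) where

  -- Subtraction modulo N, for arguments below N.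
  _⊖_ : ℕ → ℕ → ℕ
  a ⊖ b with b ≤? a
  ... | yes _ = a ∸ b
  ... | no  _ = a + N ∸ b

  ⊖-spec : ∀ {a b} → b < N → (a ⊖ b + b ≡ a) ⊎ (a ⊖ b + b ≡ a + N)
  ⊖-spec {a} {b} b<N with b ≤? a
  ... | yes b≤a = inj₁ (m∸n+n≡m b≤a)
  ... | no  _   = inj₂ (m∸n+n≡m (≤-trans (<⇒≤ b<N) (m≤n+m N a)))

  ⊖-< : ∀ {a b} → a < N → b < N → a ⊖ b < N
  ⊖-< {a} {b} a<N b<N with ⊖-spec {a} {b} b<N
  ... | inj₁ eq = ≤-<-trans (subst (a ⊖ b ≤_) eq (m≤m+n _ b)) a<N
  ... | inj₂ eq with b ≤? a
  ... | yes _   = ≤-<-trans (m∸n≤m a b) a<N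
  ... | no  b≰a = +-cancelʳ-< b _ _
    (subst₂ _<_ (sym eq) (+-comm b N) (+-monoˡ-< N (≰⇒> b≰a)))

  residue-unique : ∀ {a b} k l → a < N → b < N → a + k * N ≡ b + l * N → a ≡ b
  residue-unique {a} {b} k l a<N b<N eq = begin
    a                ≡⟨ m<n⇒m%n≡m a<N ⟨
    a % N            ≡⟨ [m+kn]%n≡m%n a k N ⟨
    (a + k * N) % N  ≡⟨ cong (_% N) eq ⟩
    (b + l * N) % N  ≡⟨ [m+kn]%n≡m%n b l N ⟩
    b % N            ≡⟨ m<n⇒m%n≡m b<N ⟩
    b                ∎
    where
    open ≡-Reasoning
    instance _ = >-nonZero (≤-<-trans z≤n a<N)

  -- The three disjunctions are the congruences `e = a - b`, `d = a + c` and `b = -c` modulo `N`, so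
  -- `e` and `d` are the same residue. In use, `c` is a rotation, `a` the rotated `d` and `b` the
  -- rotated `0`.
  ⊖-rotate : ∀ {a b c d e} → e < N → d < N → (e + b ≡ a) ⊎ (e + b ≡ a + N) →
    (a + c ≡ d) ⊎ (a + c ≡ d + N) → (b + c ≡ 0) ⊎ (b + c ≡ N) → e ≡ d
  ⊖-rotate {a} {b} {c} {d} {e} e<N d<N p? q? r? with multiple p? | multiple q? | multiple r?
    where
    multiple : ∀ {a b} → a ≡ b ⊎ a ≡ b + N → ∃ λ k → a ≡ b + k * N
    multiple {b = b} (inj₁ eq) = 0 , trans eq (sym (+-identityʳ b))
    multiple {b = b} (inj₂ eq) = 1 , trans eq (cong (b +_) (sym (*-identityˡ N)))
  ... | k , p | l , q | m , r = residue-unique m (l + k) e<N d<N (begin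
    e + m * N          ≡⟨ cong (e +_) r ⟨
    e + (b + c)        ≡⟨ +-assoc e b c ⟨
    e + b + c          ≡⟨ cong (_+ c) p ⟩
    a + k * N + c      ≡⟨ arith₁ a (k * N) c ⟩
    a + c + k * N      ≡⟨ cong (_+ k * N) q ⟩
    d + l * N + k * N  ≡⟨ arith₂ d l k N ⟩
    d + (l + k) * N    ∎)
    where
    open ≡-Reasoning
    arith₁ : ∀ a b c → a + b + c ≡ a + c + b
    arith₁ = solve-∀
    arith₂ : ∀ d l k N → d + l * N + k * N ≡ d + (l + k) * N
    arith₂ = solve-∀

-- Cyclically shifting by c > 0 sends the at most c - 1 values f i ≥ n + 1 - c below c, whereas
-- g, being parking, has at least c values below c.
parking-shift-trivial : ∀ {n c} (f g : Fin n → ℕ) → IsParking f → IsParking g → c ≤ n →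
  (∀ i → g i ≡ f i + c ⊎ g i + suc n ≡ f i + c) → c ≡ 0
parking-shift-trivial {c = zero} _ _ _ _ _ _ = refl
parking-shift-trivial {n} {suc c} f g pf pg c<n shift = ⊥-elim (1+n≰n (begin
  suc (n + n)                        ≡⟨ cong (λ m → suc (n + m)) (m∸n+n≡m (<⇒≤ c<n)) ⟨
  suc (n + (n ∸ c + c))              ≡⟨ arith n (n ∸ c) c ⟩
  n + ((n ∸ c) + suc c)              ≤⟨ +-monoˡ-≤ _ (count-cover high low cover) ⟩
  (count high + count low) + ((n ∸ c) + suc c)
    ≡⟨ interchange (count high) _ _ _ ⟩
  (count high + (n ∸ c)) + (count low + suc c)
    ≤⟨ +-mono-≤ (pf (m∸n≤m n c)) (pg c<n) ⟩
  n + n                              ∎))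
  where
  open ≤-Reasoning
  high = λ i → n ∸ c ≤? f i
  low  = λ i → suc c ≤? g i
  arith : ∀ n m c → suc (n + (m + c)) ≡ n + (m + suc c)
  arith = solve-∀
  cover : ∀ i → n ∸ c ≤ f i ⊎ suc c ≤ g i
  cover i with shift i
  ... | inj₁ eq = inj₂ (subst (suc c ≤_) (sym eq) (m≤n+m _ (f i)))
  ... | inj₂ eq = inj₁ (m≤n+o⇒m∸n≤o n c (s≤s⁻¹ (begin
    suc n          ≤⟨ m≤n+m (suc n) (g i) ⟩
    g i + suc n    ≡⟨ eq ⟩
    f i + suc c    ≡⟨ +-comm (f i) _ ⟩
    suc (c + f i)  ∎)))

first-argmax : (h : ℕ → ℕ) → ∀ k →
  ∃ λ c → c ≤ k × (∀ {v} → v ≤ k → h v ≤ h c) × (∀ {v} → v < c → h v < h c)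
first-argmax h zero = 0 , z≤n , (λ where z≤n → ≤-refl) , λ ()
first-argmax h (suc k) with first-argmax h k
... | c , c≤k , max , first with h (suc k) ≤? h c
...   | yes le = c , m≤n⇒m≤1+n c≤k , max′ , first
  where
  max′ : ∀ {v} → v ≤ suc k → h v ≤ h c
  max′ v≤ with m≤n⇒m<n∨m≡n v≤
  ... | inj₁ (s≤s v≤k) = max v≤k
  ... | inj₂ refl      = le
...   | no ¬le = suc k , ≤-refl , max′ , λ where (s≤s v≤k) → ≤-<-trans (max v≤k) (≰⇒> ¬le)
  where
  max′ : ∀ {v} → v ≤ suc k → h v ≤ h (suc k)
  max′ v≤ with m≤n⇒m<n∨m≡n v≤
  ... | inj₁ (s≤s v≤k) = ≤-trans (max v≤k) (<⇒≤ (≰⇒> ¬le))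
  ... | inj₂ refl      = ≤-refl

-- Cycle lemma: the rotation starts at the first maximum of v ↦ #{i ∣ v ≤ g i} + v.
parking-rotation : ∀ {n} (g : Fin n → ℕ) → (∀ i → g i ≤ n) →
  ∃ λ c → c ≤ n × IsParking (λ i → _⊖_ (suc n) (g i) c)
parking-rotation {n} g g≤n with first-argmax (λ v → count (λ i → v ≤? g i) + v) n
... | c , c≤n , max , first = c , c≤n , parking
  where
  open ≤-Reasoning
  f : Fin n → ℕ
  f i = _⊖_ (suc n) (g i) c
  #g≥ : ℕ → ℕ
  #g≥ v = count (λ i → v ≤? g i)
  spec : ∀ i → (f i + c ≡ g i) ⊎ (f i + c ≡ g i + suc n)
  spec i = ⊖-spec (suc n) (s≤s c≤n)

  f+c≡g : ∀ i → c ≤ g i → f i + c ≡ g i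
  f+c≡g i c≤gi with spec i
  ... | inj₁ eq = eq
  ... | inj₂ eq = contradiction (+-cancelʳ-≤ c _ _ (begin
    suc n + c      ≡⟨ +-comm (suc n) c ⟩
    c + suc n      ≤⟨ +-monoˡ-≤ _ c≤gi ⟩
    g i + suc n    ≡⟨ eq ⟨
    f i + c        ∎)) (<⇒≱ (⊖-< (suc n) (s≤s (g≤n i)) (s≤s c≤n)))

  arith₁ : ∀ p q m c j → p + j + (q + (m + c)) ≡ (p + q) + (m + (c + j))
  arith₁ = solve-∀
  arith₂ : ∀ m n c j → (m + n) + (c + j) ≡ n + (m + (c + j))
  arith₂ = solve-∀
  arith₃ : ∀ p q j c → p + j + (q + c) ≡ (p + q) + (c + j)
  arith₃ = solve-∀
  arith₄ : ∀ m n e → m + (suc n + e) ≡ n + suc (m + e)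
  arith₄ = solve-∀

  parking : IsParking f
  parking {j} j≤n with c + j ≤? n
  -- Without wrapping, `j ≤ f i` and `c ≤ g i` together give `c + j ≤ g i`, and the union of the two
  -- sets has at most `n` elements. Maximality at `c` then suffices.
  ... | yes c+j≤n = +-cancelʳ-≤ (#g≥ (c + j) + (c + j)) _ _ (begin
    #f≥j + j + (#g≥ (c + j) + (c + j))   ≤⟨ +-monoʳ-≤ (#f≥j + j) (max c+j≤n) ⟩
    #f≥j + j + (#g≥ c + c)               ≡⟨ arith₃ #f≥j (#g≥ c) j c ⟩
    (#f≥j + #g≥ c) + (c + j)             ≤⟨ +-monoˡ-≤ (c + j)
      (count-modular (λ i → j ≤? f i) (λ i → c ≤? g i) (λ i → c + j ≤? g i) ⊤?
        (λ _ _ → inj₂ tt)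
        (λ i j≤f c≤g →
          subst (c + j ≤_) (trans (+-comm c (f i)) (f+c≡g i c≤g)) (+-monoʳ-≤ c j≤f) , tt)) ⟩
    (#g≥ (c + j) + count {n} ⊤?) + (c + j) ≡⟨ cong (λ m → #g≥ (c + j) + m + (c + j)) (count-⊤ n) ⟩
    (#g≥ (c + j) + n) + (c + j)          ≡⟨ arith₂ (#g≥ (c + j)) n c j ⟩
    n + (#g≥ (c + j) + (c + j))          ∎)
    where #f≥j = count (λ i → j ≤? f i)
  -- With wrapping, the two sets are disjoint and both lie in the set of `i` with `e ≤ g i`, where
  -- `e` is `c + j` reduced modulo `n + 1`.
  ... | no c+j≰n = +-cancelʳ-≤ (#g≥ c + c) _ _ (begin
    #f≥j + j + (#g≥ c + c)               ≡⟨ arith₃ #f≥j (#g≥ c) j c ⟩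
    (#f≥j + #g≥ c) + (c + j)             ≤⟨ +-monoˡ-≤ (c + j)
      (count-modular (λ i → j ≤? f i) (λ i → c ≤? g i) (λ i → e ≤? g i) ⊥? one both) ⟩
    (#g≥ e + count {n} ⊥?) + (c + j)     ≡⟨ cong₂ _+_ (+-count-⊥ n _) (sym N+e) ⟩
    #g≥ e + (suc n + e)                  ≡⟨ arith₄ (#g≥ e) n e ⟩
    -- The modulus exceeds `n` by one. This unit is absorbed because `c` is the first maximum, so
    -- that the value at `e < c` is strictly smaller.
    n + suc (#g≥ e + e)                  ≤⟨ +-monoʳ-≤ n (first e<c) ⟩
    n + (#g≥ c + c)                      ∎)
    where
    #f≥j = count (λ i → j ≤? f i)
    e = c + j ∸ suc n
    N+e : suc n + e ≡ c + j
    N+e = m+[n∸m]≡n (≰⇒> c+j≰n)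
    e<c : e < c
    e<c = +-cancelˡ-< (suc n) _ _ (begin-strict
      suc n + e   ≡⟨ N+e ⟩
      c + j       <⟨ +-monoʳ-< c (s≤s j≤n) ⟩
      c + suc n   ≡⟨ +-comm c _ ⟩
      suc n + c   ∎)
    big : ∀ {i} → j ≤ f i → f i + c ≡ g i → ⊥
    big {i} j≤f eq = c+j≰n (begin
      c + j      ≤⟨ +-monoʳ-≤ c j≤f ⟩
      c + f i    ≡⟨ +-comm c _ ⟩
      f i + c    ≡⟨ eq ⟩
      g i        ≤⟨ g≤n i ⟩
      n          ∎)
    one : ∀ i → j ≤ f i ⊎ c ≤ g i → e ≤ g i ⊎ ⊥
    one i (inj₂ c≤g) = inj₁ (≤-trans (<⇒≤ e<c) c≤g)
    one i (inj₁ j≤f) with spec i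
    ... | inj₁ eq = ⊥-elim (big j≤f eq)
    ... | inj₂ eq = inj₁ (+-cancelˡ-≤ (suc n) _ _ (begin
      suc n + e   ≡⟨ N+e ⟩
      c + j       ≤⟨ +-monoʳ-≤ c j≤f ⟩
      c + f i     ≡⟨ +-comm c _ ⟩
      f i + c     ≡⟨ eq ⟩
      g i + suc n ≡⟨ +-comm (g i) _ ⟩
      suc n + g i ∎))
    both : ∀ i → j ≤ f i → c ≤ g i → e ≤ g i × ⊥
    both i j≤f c≤g = ⊥-elim (big j≤f (f+c≡g i c≤g))

-- The Pollak code records f up to rotation by its differences to f 0 modulo n + 1.
module _ {n : ℕ} where

  private
    N = suc (suc n)

  pollak : (Fin (suc n) → ℕ) → Fin n → ℕ
  pollak f i = _⊖_ N (f (Fin.suc i)) (f Fin.zero)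

  private
    -- Equal differences make `g` the rotation of `f` by `c = g 0 - f 0`, so `parking-shift-trivial`
    -- gives `c = 0`. The assumption `f 0 ≤ g 0` makes `c` an ordinary difference.
    pollak-injective-≤ : (f g : Fin (suc n) → ℕ) → IsParking f → IsParking g →
      f Fin.zero ≤ g Fin.zero → (∀ i → pollak f i ≡ pollak g i) → ∀ i → f i ≡ g i
    pollak-injective-≤ f g pf pg f0≤g0 eqs i = f≡g (shift i)
      where
      f0 = f Fin.zero
      g0 = g Fin.zero
      c = g0 ∸ f0
      f0+c : f0 + c ≡ g0
      f0+c = m+[n∸m]≡n f0≤g0
      f<N : ∀ i → f i < N
      f<N i = m≤n⇒m≤1+n (parking-< f pf i)
      g<N : ∀ i → g i < N
      g<N i = m≤n⇒m≤1+n (parking-< g pg i)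
      too-big : ∀ {a b} → a < N → a ≡ b + N + c → ⊥
      too-big {a} {b} a<N eq = <⇒≱ a<N
        (subst (N ≤_) (sym eq) (≤-trans (m≤n+m N b) (m≤m+n _ c)))
      swap-last : ∀ a k c → a + k + c ≡ a + c + k
      swap-last = solve-∀
      shift : ∀ i → g i ≡ f i + c ⊎ g i + N ≡ f i + c
      shift Fin.zero = inj₁ (sym f0+c)
      shift (Fin.suc i) = resolve (⊖-spec N (f<N Fin.zero)) (⊖-spec N (g<N Fin.zero))
        where
        e+g0 : pollak g i + g0 ≡ pollak f i + f0 + c
        e+g0 = trans (cong₂ _+_ (sym (eqs i)) (sym f0+c)) (sym (+-assoc (pollak f i) f0 c))
        a = f (Fin.suc i)
        b = g (Fin.suc i)
        resolve : (pollak f i + f0 ≡ a) ⊎ (pollak f i + f0 ≡ a + N) →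
                  (pollak g i + g0 ≡ b) ⊎ (pollak g i + g0 ≡ b + N) →
                  b ≡ a + c ⊎ b + N ≡ a + c
        resolve (inj₁ p) (inj₁ q) = inj₁ (trans (sym q) (trans e+g0 (cong (_+ c) p)))
        resolve (inj₁ p) (inj₂ q) = inj₂ (trans (sym q) (trans e+g0 (cong (_+ c) p)))
        resolve (inj₂ p) (inj₁ q) =
          ⊥-elim (too-big (g<N (Fin.suc i)) (trans (sym q) (trans e+g0 (cong (_+ c) p))))
        resolve (inj₂ p) (inj₂ q) = inj₁ (+-cancelʳ-≡ N _ _
          (trans (sym q) (trans e+g0 (trans (cong (_+ c) p) (swap-last a N c)))))
      c≡0 : c ≡ 0
      c≡0 = parking-shift-trivial f g pf pg
        (≤-trans (m∸n≤m g0 f0) (<⇒≤ (parking-< g pg Fin.zero))) shift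
      f+c≡f : f i + c ≡ f i
      f+c≡f = trans (cong (f i +_) c≡0) (+-identityʳ _)
      f≡g : g i ≡ f i + c ⊎ g i + N ≡ f i + c → f i ≡ g i
      f≡g (inj₁ eq) = sym (trans eq f+c≡f)
      f≡g (inj₂ eq) = contradiction (subst (N ≤_) (trans eq f+c≡f) (m≤n+m N _)) (<⇒≱ (f<N i))

  pollak-injective : (f g : Fin (suc n) → ℕ) → IsParking f → IsParking g →
    (∀ i → pollak f i ≡ pollak g i) → ∀ i → f i ≡ g i
  pollak-injective f g pf pg eqs i with ≤-total (f Fin.zero) (g Fin.zero)
  ... | inj₁ le = pollak-injective-≤ f g pf pg le eqs i
  ... | inj₂ ge = sym (pollak-injective-≤ g f pg pf ge (sym ∘ eqs) i)

  pollak-< : (f : Fin (suc n) → ℕ) → IsParking f → ∀ i → pollak f i < N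
  pollak-< f pf i = ⊖-< N (m≤n⇒m≤1+n (parking-< f pf _)) (m≤n⇒m≤1+n (parking-< f pf _))

  -- Prepending `0` picks a representative of the rotation class. Rotating it to a parking function
  -- leaves the differences to the first value unchanged.
  pollak-surjective : (d : Fin n → ℕ) → (∀ i → d i < N) →
    ∃ λ (f : Fin (suc n) → ℕ) → IsParking f × (∀ i → pollak f i ≡ d i)
  pollak-surjective d d<N = f , pf , pollak-f
    where
    g : Fin (suc n) → ℕ
    g Fin.zero    = 0
    g (Fin.suc i) = d i
    g≤ : ∀ i → g i ≤ suc n
    g≤ Fin.zero    = z≤n
    g≤ (Fin.suc i) = s≤s⁻¹ (d<N i)
    rotation = parking-rotation g g≤
    c  = proj₁ rotation
    pf = proj₂ (proj₂ rotation)
    c<N : c < N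
    c<N = s≤s (proj₁ (proj₂ rotation))
    f : Fin (suc n) → ℕ
    f i = _⊖_ N (g i) c
    pollak-f : ∀ i → pollak f i ≡ d i
    pollak-f i = ⊖-rotate N (pollak-< f pf i) (d<N i)
      (⊖-spec N {f (Fin.suc i)} {f Fin.zero} (m≤n⇒m≤1+n (parking-< f pf Fin.zero)))
      (⊖-spec N {d i} c<N) (⊖-spec N {0} c<N)

-- Pollak codes as numbers, and counting by parking functions

funToFin-cong : ∀ {m n} {f g : Fin m → Fin n} → f ≗ g → funToFin f ≡ funToFin g
funToFin-cong {zero}  _  = refl
funToFin-cong {suc m} eq = cong₂ combine (eq Fin.zero) (funToFin-cong (eq ∘ Fin.suc))

pollakFin : ∀ {n} (f : Fin (suc n) → ℕ) → IsParking f → Fin n → Fin (suc (suc n))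
pollakFin f pf i = fromℕ< (pollak-< f pf i)

toℕ-pollakFin : ∀ {n} (f : Fin (suc n) → ℕ) (pf : IsParking f) i → toℕ (pollakFin f pf i) ≡ pollak f i
toℕ-pollakFin f pf i = Fin.toℕ-fromℕ< (pollak-< f pf i)

pollakFin-injective : ∀ {n} (f g : Fin (suc n) → ℕ) (pf : IsParking f) (pg : IsParking g) →
  funToFin (pollakFin f pf) ≡ funToFin (pollakFin g pg) → f ≗ g
pollakFin-injective f g pf pg eq = pollak-injective f g pf pg λ i → begin
    pollak f i                                  ≡⟨ toℕ-pollakFin f pf i ⟨
    toℕ (pollakFin f pf i)                      ≡⟨ cong toℕ (Fin.finToFun-funToFin (pollakFin f pf) i) ⟨
    toℕ (finToFun (funToFin (pollakFin f pf)) i) ≡⟨ cong (λ k → toℕ (finToFun k i)) eq ⟩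
    toℕ (finToFun (funToFin (pollakFin g pg)) i) ≡⟨ cong toℕ (Fin.finToFun-funToFin (pollakFin g pg) i) ⟩
    toℕ (pollakFin g pg i)                      ≡⟨ toℕ-pollakFin g pg i ⟩
    pollak g i                 ∎
    where open ≡-Reasoning

pollakFin-surjective : ∀ {n} (k : Fin (suc (suc n) ^ n)) →
  ∃ λ (f : Fin (suc n) → ℕ) → IsParking f × (∀ i → pollak f i ≡ toℕ (finToFun k i))
pollakFin-surjective k = pollak-surjective (toℕ ∘ finToFun k) (λ i → Fin.toℕ<n (finToFun k i))

pollak-cong : ∀ {n} {f g : Fin (suc n) → ℕ} → f ≗ g → ∀ i → pollak f i ≡ pollak g i
pollak-cong {n} eq i = cong₂ (_⊖_ (suc (suc n))) (eq (Fin.suc i)) (eq Fin.zero)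

injection-with-section : ∀ {A B : Set} (f : A → B) → (∀ {x y} → f x ≡ f y → x ≡ y) →
  (∀ y → ∃ λ x → f x ≡ y) → A ↔ B
injection-with-section f inj section =
  mk↔ₛ′ f (proj₁ ∘ section) (proj₂ ∘ section) (λ x → inj (proj₂ (section (f x))))

-- Parking functions are only available up to pointwise equality, so `X` is matched directly with
-- their Pollak codes: `n` residues modulo `n + 2` for a map on `n + 1` points.
parking-coded : ∀ {X : Set} {n} (f : X → Fin (suc n) → ℕ) → (∀ x → IsParking (f x)) →
  (∀ x y → f x ≗ f y → x ≡ y) → (∀ g → IsParking g → ∃ λ x → f x ≗ g) →
  X ↔ Fin (suc (suc n) ^ n)
parking-coded {n = n} f pf f-injective f-surjective = injection-with-section
  (λ x → funToFin (pollakFin (f x) (pf x)))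
  (λ {x} {y} eq → f-injective x y (pollakFin-injective (f x) (f y) (pf x) (pf y) eq))
  λ k →
    let g , pg , pollak-g = pollakFin-surjective k
        x , fx≗g = f-surjective g pg
    in x , trans
      (funToFin-cong λ i → Fin.toℕ-injective
        (trans (toℕ-pollakFin (f x) (pf x) i) (trans (pollak-cong fx≗g i) (pollak-g i))))
      (Fin.funToFin-finToFin {n} k)

-- The parking process

minimal : ∀ {n} {P : Fin n → Set} (P? : Decidable P) (key : Fin n → ℕ) → ∃ P →
  ∃ λ i → P i × (∀ {j} → P j → key i ≤ key j)
minimal {P = P} P? key (i , p) = go i p (<-wellFounded (key i))
  where
  go : ∀ i → P i → Acc _<_ (key i) → ∃ λ i → P i × (∀ {j} → P j → key i ≤ key j)
  go i p (acc rec) with Fin.any? (λ j → P? j ×-dec (key j <? key i))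
  ... | yes (j , q , lt) = go j q (rec lt)
  ... | no none = i , p , λ {j} q → ≮⇒≥ λ lt → none (j , q , lt)

-- The increasing map that skips the value `k`: it makes room for a new row at position `k`.
bump : ℕ → ℕ → ℕ
bump k p with k ≤? p
... | yes _ = suc p
... | no  _ = p

bump-≤ : ∀ k p → bump k p ≤ suc p
bump-≤ k p with k ≤? p
... | yes _ = ≤-refl
... | no  _ = n≤1+n p

bump-≢ : ∀ k p → bump k p ≢ k
bump-≢ k p with k ≤? p
... | yes k≤p = λ eq → <-irrefl (sym eq) (s≤s k≤p)
... | no  k≰p = λ eq → k≰p (≤-reflexive (sym eq))

bump-low : ∀ {k p} → p < k → bump k p ≡ p
bump-low {k} {p} p<k with k ≤? p
... | yes k≤p = contradiction k≤p (<⇒≱ p<k)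
... | no  _   = refl

bump-<⁻ : ∀ {k p} → bump k p < k → p < k
bump-<⁻ {k} {p} lt with k ≤? p
... | yes _ = <⇒≤ lt
... | no  _ = lt

bump-mono-< : ∀ {k p q} → p < q → bump k p < bump k q
bump-mono-< {k} {p} {q} p<q with k ≤? p | k ≤? q
... | yes _   | yes _   = s≤s p<q
... | yes k≤p | no  k≰q = contradiction (≤-trans k≤p (<⇒≤ p<q)) k≰q
... | no  _   | yes _   = m≤n⇒m≤1+n p<q
... | no  _   | no  _   = p<q

bump-cancel-< : ∀ {k p q} → bump k p < bump k q → p < q
bump-cancel-< {k} {p} {q} lt = ≰⇒> λ q≤p → case m≤n⇒m<n∨m≡n q≤p of λ where
  (inj₁ q<p)  → <-asym lt (bump-mono-< q<p)
  (inj₂ refl) → <-irrefl refl lt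

bump-injective : ∀ {k p q} → bump k p ≡ bump k q → p ≡ q
bump-injective {k} {p} {q} eq with <-cmp p q
... | tri< p<q _ _ = contradiction eq (<⇒≢ (bump-mono-< p<q))
... | tri≈ _ p≡q _ = p≡q
... | tri> _ _ q<p = contradiction (sym eq) (<⇒≢ (bump-mono-< q<p))

record IsRanking {n} (key : Fin n → ℕ) : Set where
  field
    injective : ∀ {i j} → key i ≡ key j → i ≡ j
    bounded   : ∀ i → key i < n

open IsRanking

-- tm and pos list the rows by decreasing entry in column 2 and column 1, respectively.
Compatible : ∀ {n} → (Fin n → ℕ) → (Fin n → ℕ) → Set
Compatible tm pos = ∀ {i r m} → i Fin.< r → tm r < tm i → tm m ≤ tm r → pos m < pos i

below? : ∀ {n} (tm pos : Fin n → ℕ) (i : Fin n) → Decidable (λ m → tm m < tm i × pos m < pos i)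
below? tm pos i m = (tm m <? tm i) ×-dec (pos m <? pos i)

code : ∀ {n} → (Fin n → ℕ) → (Fin n → ℕ) → Fin n → ℕ
code tm pos i = count (below? tm pos i)

-- Spot t is taken by the first row, among the unparked ones whose preferred spot f i is at most t.
-- It enters the order of the first column so that exactly f i parked rows lie above it.
record Stage {n} (f : Fin n → ℕ) (t : ℕ) : Set where
  field
    tm pos        : Fin n → ℕ
    -- The value `n` marks the rows that are still unparked.
    parked        : ∀ i → tm i < t ⊎ tm i ≡ n
    tm-injective  : ∀ {i j} → tm i < t → tm j < t → tm i ≡ tm j → i ≡ j
    parked-count  : count (λ i → tm i <? t) ≡ t
    pos-<         : ∀ {i} → tm i < t → pos i < t
    pos-injective : ∀ {i j} → tm i < t → tm j < t → pos i ≡ pos j → i ≡ j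
    compatible    : ∀ {i r m} → tm i < t → i Fin.< r → tm r < tm i → tm m ≤ tm r → pos m < pos i
    -- Turns into `compatible` for `i` once `i` parks. A row `r > i` that parked earlier did so
    -- while `i` was not yet eligible, so all positions used up to then were below `f i`.
    waiting       : ∀ {i r m} → ¬ tm i < t → f i ≤ t → i Fin.< r → tm r < t → tm m ≤ tm r →
                    pos m < f i
    code≡f        : ∀ {i} → tm i < t → code tm pos i ≡ f i

stage-zero : ∀ {n} (f : Fin n → ℕ) → Stage f 0
stage-zero {n} f = record
  { tm = λ _ → n ; pos = λ _ → 0 ; parked = λ _ → inj₂ refl
  ; tm-injective = λ ()
  ; parked-count = trans
      (count-cong {n} {λ _ → n < 0} (λ _ → n <? 0) ⊥? (λ _ ()) (λ _ ())) (count-⊥ n)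
  ; pos-< = λ () ; pos-injective = λ () ; compatible = λ () ; waiting = λ _ _ _ ()
  ; code≡f = λ () }

-- At `j = t + 1` the parking condition gives at least `t + 1` rows with preference at most `t`, and
-- only `t` rows are parked.
someone-waits : ∀ {n} {f : Fin n → ℕ} → IsParking f → ∀ {t} → t < n → (stage : Stage f t) →
  ∃ λ i → (¬ Stage.tm stage i < t) × f i ≤ t
someone-waits {n} {f} pf {t} t<n stage =
  let i , p , q = count<⇒∃ parked? early? (subst (_< count early?) (sym parked-count) early>t)
  in i , q , p
  where
  open Stage stage
  open ≤-Reasoning
  parked? : Decidable (λ i → tm i < t)
  parked? i = tm i <? t
  early? : Decidable (λ i → f i ≤ t)
  early? i = f i ≤? t
  late? : Decidable (λ i → suc t ≤ f i)
  late? i = suc t ≤? f i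
  early>t : t < count early?
  early>t = +-cancelʳ-≤ (count late?) _ _ (begin
    suc t + count late?         ≡⟨ +-comm (suc t) _ ⟩
    count late? + suc t         ≤⟨ pf t<n ⟩
    n                           ≤⟨ count-cover early? late? (λ i → ≤-<-connex (f i) t) ⟩
    count early? + count late?  ∎)

module Park {n} {f : Fin n → ℕ} {t} (t<n : t < n) (stage : Stage f t)
  (x : Fin n) (x-unparked : ¬ Stage.tm stage x < t) (fx≤t : f x ≤ t)
  (x-first : ∀ {j} → ¬ Stage.tm stage j < t → f j ≤ t → x Fin.≤ j) where

  open Stage stage

  private
    tm′ pos′ : Fin n → ℕ
    tm′ = updateAt tm x (λ _ → t)
    pos′ = updateAt (bump (f x) ∘ pos) x (λ _ → f x)

    tm-x : tm′ x ≡ t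
    tm-x = updateAt-updates x tm
    pos-x : pos′ x ≡ f x
    pos-x = updateAt-updates x (bump (f x) ∘ pos)
    tm-old : ∀ {i} → i ≢ x → tm′ i ≡ tm i
    tm-old {i} i≢x = updateAt-minimal i x tm i≢x
    pos-old : ∀ {i} → i ≢ x → pos′ i ≡ bump (f x) (pos i)
    pos-old {i} i≢x = updateAt-minimal i x (bump (f x) ∘ pos) i≢x

    old⇒≢x : ∀ {i} → tm i < t → i ≢ x
    old⇒≢x lt refl = x-unparked lt

    data Parked (i : Fin n) : Set where
      new : i ≡ x → Parked i
      old : i ≢ x → tm i < t → tm′ i ≡ tm i → pos′ i ≡ bump (f x) (pos i) → Parked i

    view : ∀ i → tm′ i < suc t → Parked i
    view i lt with i Fin.≟ x
    ... | yes i≡x = new i≡x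
    ... | no i≢x with parked i
    ...   | inj₁ tm<t = old i≢x tm<t (tm-old i≢x) (pos-old i≢x)
    ...   | inj₂ tm≡n = contradiction
            (subst (_< suc t) (trans (tm-old i≢x) tm≡n) lt) (≤⇒≯ t<n)

    before : ∀ {i} → tm′ i < t → i ≢ x × tm i < t
    before {i} lt with i Fin.≟ x
    ... | yes refl = contradiction lt (<-irrefl tm-x)
    ... | no i≢x = i≢x , subst (_< t) (tm-old i≢x) lt

  next : Stage f (suc t)
  next = record
    { tm = tm′ ; pos = pos′ ; parked = parked′ ; tm-injective = tm-injective′
    ; parked-count = parked-count′ ; pos-< = pos-<′ ; pos-injective = pos-injective′
    ; compatible = compatible′ ; waiting = waiting′ ; code≡f = code≡f′ }
    where
    parked′ : ∀ i → tm′ i < suc t ⊎ tm′ i ≡ n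
    parked′ i with i Fin.≟ x
    ... | yes refl = inj₁ (s≤s (≤-reflexive tm-x))
    ... | no i≢x with parked i
    ...   | inj₁ lt = inj₁ (m≤n⇒m≤1+n (subst (_< t) (sym (tm-old i≢x)) lt))
    ...   | inj₂ eq = inj₂ (trans (tm-old i≢x) eq)

    tm-injective′ : ∀ {i j} → tm′ i < suc t → tm′ j < suc t → tm′ i ≡ tm′ j → i ≡ j
    tm-injective′ {i} {j} pi pj eq with view i pi | view j pj
    ... | new refl | new refl = refl
    ... | new refl | old _ lt e _ = contradiction (trans (sym e) (trans (sym eq) tm-x)) (<⇒≢ lt)
    ... | old _ lt e _ | new refl = contradiction (trans (sym e) (trans eq tm-x)) (<⇒≢ lt)
    ... | old _ lt e _ | old _ lt₁ e₁ _ = tm-injective lt lt₁ (trans (sym e) (trans eq e₁))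

    parked-count′ : count (λ i → tm′ i <? suc t) ≡ suc t
    parked-count′ = ≤-antisym
      (begin
        count new?                               ≡⟨ +-count-⊥ n _ ⟨
        count new? + count {n} ⊥?                ≤⟨ count-modular new? ⊥? (Fin._≟ x) old?
                                                      (λ i → [ split i , (λ ()) ]) (λ _ _ ()) ⟩
        count (Fin._≟ x) + count old?            ≤⟨ +-monoˡ-≤ _
          (count-subsingleton (Fin._≟ x) λ p q → trans p (sym q)) ⟩
        suc (count old?)                         ≡⟨ cong suc parked-count ⟩
        suc t                                    ∎)
      (subst (_< count new?) parked-count
        (count-strict old? new?
          (λ i lt → m≤n⇒m≤1+n (subst (_< t) (sym (tm-old (old⇒≢x lt))) lt))
          (s≤s (≤-reflexive tm-x)) x-unparked))
      where
      open ≤-Reasoning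
      new? : Decidable (λ i → tm′ i < suc t)
      new? i = tm′ i <? suc t
      old? : Decidable (λ i → tm i < t)
      old? i = tm i <? t
      split : ∀ i → tm′ i < suc t → i ≡ x ⊎ tm i < t
      split i lt with view i lt
      ... | new eq = inj₁ eq
      ... | old _ lt′ _ _ = inj₂ lt′

    pos-<′ : ∀ {i} → tm′ i < suc t → pos′ i < suc t
    pos-<′ {i} lt with view i lt
    ... | new refl = s≤s (subst (_≤ t) (sym pos-x) fx≤t)
    ... | old _ lt′ _ e = s≤s (subst (_≤ t) (sym e) (≤-trans (bump-≤ (f x) (pos i)) (pos-< lt′)))

    pos-injective′ : ∀ {i j} → tm′ i < suc t → tm′ j < suc t → pos′ i ≡ pos′ j → i ≡ j
    pos-injective′ {i} {j} pi pj eq with view i pi | view j pj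
    ... | new refl | new refl = refl
    ... | new refl | old _ _ _ e =
      contradiction (trans (sym e) (trans (sym eq) pos-x)) (bump-≢ (f x) (pos j))
    ... | old _ _ _ e | new refl =
      contradiction (trans (sym e) (trans eq pos-x)) (bump-≢ (f x) (pos i))
    ... | old _ lt _ e | old _ lt₁ _ e₁ =
      pos-injective lt lt₁ (bump-injective (trans (sym e) (trans eq e₁)))

    -- A row r > x parked before x cannot have passed over x while x was waiting.
    passed : ∀ {r m} → x Fin.< r → tm′ r < t → tm′ m ≤ tm′ r →
      pos m < f x × pos′ m ≡ pos m
    passed {r} {m} x<r r<t m≤r = low , trans (pos-old m≢x) (bump-low low)
      where
      r≢x = proj₁ (before r<t)
      m≢x = proj₁ (before (≤-<-trans m≤r r<t))
      low : pos m < f x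
      low = waiting x-unparked fx≤t x<r (proj₂ (before r<t)) (subst₂ _≤_ (tm-old m≢x) (tm-old r≢x) m≤r)

    compatible′ : ∀ {i r m} → tm′ i < suc t → i Fin.< r → tm′ r < tm′ i → tm′ m ≤ tm′ r →
      pos′ m < pos′ i
    compatible′ {i} {r} {m} pi i<r r<i m≤r with view i pi
    ... | new refl = subst₂ _<_ (sym (proj₂ p)) (sym pos-x) (proj₁ p)
      where p = passed i<r (subst (tm′ r <_) tm-x r<i) m≤r
    ... | old i≢x i<t tm-i pos-i = subst₂ _<_ (sym (pos-old m≢x)) (sym pos-i)
      (bump-mono-< (compatible i<t i<r (subst₂ _<_ (tm-old r≢x) tm-i r<i)
        (subst₂ _≤_ (tm-old m≢x) (tm-old r≢x) m≤r)))
      where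
      r<t : tm′ r < t
      r<t = <-trans r<i (subst (_< t) (sym tm-i) i<t)
      r≢x = proj₁ (before r<t)
      m≢x = proj₁ (before (≤-<-trans m≤r r<t))

    waiting′ : ∀ {i r m} → ¬ tm′ i < suc t → f i ≤ suc t → i Fin.< r → tm′ r < suc t →
      tm′ m ≤ tm′ r → pos′ m < f i
    waiting′ {i} {r} {m} ¬pi fi≤ i<r r<t m≤r with m≤n⇒m<n∨m≡n fi≤
    -- A row with preference `t + 1` becomes eligible only now, and the positions of all parked rows
    -- are still below `t + 1`.
    ... | inj₂ eq = subst (pos′ m <_) (sym eq) (pos-<′ (≤-<-trans m≤r r<t))
    ... | inj₁ (s≤s fi≤t) with view r r<t
    ...   | new refl = contradiction i<r (≤⇒≯ (x-first ¬old fi≤t))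
      where
      ¬old : ¬ tm i < t
      ¬old lt = ¬pi (m≤n⇒m≤1+n (subst (_< t) (sym (tm-old (old⇒≢x lt))) lt))
    -- Both `i` and `x` were waiting and `x ≤ i < r`, so the position of `m` is below `f x` as well
    -- as below `f i`; inserting `x` does not move it.
    ...   | old r≢x r<t′ tm-r _ = subst (_< f i) (sym (proj₂ p))
            (waiting ¬old fi≤t i<r r<t′ (subst₂ _≤_ (tm-old m≢x) tm-r m≤r))
      where
      ¬old : ¬ tm i < t
      ¬old lt = ¬pi (m≤n⇒m≤1+n (subst (_< t) (sym (tm-old (old⇒≢x lt))) lt))
      r<t″ : tm′ r < t
      r<t″ = subst (_< t) (sym tm-r) r<t′
      m≢x = proj₁ (before (≤-<-trans m≤r r<t″))
      x<r : x Fin.< r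
      x<r = ≤-<-trans (x-first ¬old fi≤t) i<r
      p = passed x<r r<t″ m≤r

    code≡f′ : ∀ {i} → tm′ i < suc t → code tm′ pos′ i ≡ f i
    code≡f′ {i} pi with view i pi
    -- The `t` rows parked before occupy exactly the positions below `t`, so `f x` of them precede
    -- the insertion point `f x`.
    ... | new refl = trans
      (count-cong (below? tm′ pos′ x) (λ m → (tm m <? t) ×-dec (pos m <? f x)) to from)
      (count-below (λ m → tm m <? t) pos pos-injective pos-< (≤-reflexive (sym parked-count)) fx≤t)
      where
      to : ∀ m → tm′ m < tm′ x × pos′ m < pos′ x → tm m < t × pos m < f x
      to m (p , q) = proj₂ b , bump-<⁻ (subst₂ _<_ (pos-old (proj₁ b)) pos-x q)
        where b = before (subst (tm′ m <_) tm-x p)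
      from : ∀ m → tm m < t × pos m < f x → tm′ m < tm′ x × pos′ m < pos′ x
      from m (p , q) = subst₂ _<_ (sym (tm-old m≢x)) (sym tm-x) p ,
        subst₂ _<_ (sym (trans (pos-old m≢x) (bump-low q))) (sym pos-x) q
        where m≢x = old⇒≢x p
    -- The new row has the last spot, so no older row counts it, and `bump` preserves the order of
    -- the older rows.
    ... | old i≢x i<t tm-i pos-i = trans
      (count-cong (below? tm′ pos′ i) (below? tm pos i) to from)
      (code≡f i<t)
      where
      to : ∀ m → tm′ m < tm′ i × pos′ m < pos′ i → tm m < tm i × pos m < pos i
      to m (p , q) = subst₂ _<_ (tm-old m≢x) tm-i p , bump-cancel-< (subst₂ _<_ (pos-old m≢x) pos-i q)
        where m≢x = proj₁ (before (<-trans p (subst (_< t) (sym tm-i) i<t)))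
      from : ∀ m → tm m < tm i × pos m < pos i → tm′ m < tm′ i × pos′ m < pos′ i
      from m (p , q) = subst₂ _<_ (sym (tm-old m≢x)) (sym tm-i) p ,
        subst₂ _<_ (sym (pos-old m≢x)) (sym pos-i) (bump-mono-< q)
        where m≢x = old⇒≢x (<-trans p i<t)

stage-suc : ∀ {n} {f : Fin n → ℕ} → IsParking f → ∀ {t} → t < n → Stage f t → Stage f (suc t)
stage-suc {f = f} pf {t} t<n stage
  with minimal (λ i → ¬? (Stage.tm stage i <? t) ×-dec (f i ≤? t)) toℕ (someone-waits pf t<n stage)
... | x , (x-unparked , fx≤t) , x-first =
  Park.next t<n stage x x-unparked fx≤t λ ¬p le → x-first (¬p , le)

stages : ∀ {n} {f : Fin n → ℕ} → IsParking f → ∀ t → t ≤ n → Stage f t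
stages {f = f} pf zero    _   = stage-zero f
stages         pf (suc t) t<n = stage-suc pf t<n (stages pf t (<⇒≤ t<n))

code-surjective : ∀ {n} (f : Fin n → ℕ) → IsParking f →
  ∃₂ λ tm pos → IsRanking tm × IsRanking pos × Compatible tm pos × (∀ i → code tm pos i ≡ f i)
code-surjective {n} f pf = tm , pos ,
  record { injective = tm-injective (all _) (all _) ; bounded = all } ,
  record { injective = pos-injective (all _) (all _) ; bounded = λ i → pos-< (all i) } ,
  compatible (all _) , λ i → code≡f (all i)
  where
  open Stage (stages pf n ≤-refl)
  all : ∀ i → tm i < n
  all i = decidable-stable (tm i <? n) λ ¬lt → <-irrefl parked-count
    (<-≤-trans (count-strict (λ i → tm i <? n) ⊤? (λ _ _ → tt) tt ¬lt) (≤-reflexive (count-⊤ n)))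

-- Recovering the rankings from the code

module _ {n} {key : Fin n → ℕ} (ranking : IsRanking key) where

  count-< : ∀ {v} → v ≤ n → count (λ i → key i <? v) ≡ v
  count-< {v} v≤n = trans
    (count-cong (λ i → key i <? v) (λ i → ⊤? i ×-dec (key i <? v)) (λ _ lt → tt , lt) (λ _ → proj₂))
    (count-below ⊤? key (λ _ _ → injective ranking) (λ _ → bounded ranking _)
      (≤-reflexive (sym (count-⊤ n))) v≤n)

  ranking-surjective : ∀ {v} → v < n → ∃ λ i → key i ≡ v
  ranking-surjective {v} v<n =
    let i , i≤v , i≮v = count<⇒∃ (λ i → key i <? v) (λ i → key i <? suc v)
          (subst₂ _<_ (sym (count-< (<⇒≤ v<n))) (sym (count-< v<n)) ≤-refl)
    in i , ≤-antisym (s≤s⁻¹ i≤v) (≮⇒≥ i≮v)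

-- A ranking is recovered from its order: the value at `i` is the number of smaller values.
ranking-unique : ∀ {n} {p q : Fin n → ℕ} → IsRanking p → IsRanking q →
  (∀ {i j} → p i < p j → q i < q j) → (∀ {i j} → q i < q j → p i < p j) → ∀ i → p i ≡ q i
ranking-unique {p = p} {q} rp rq to from i = begin
  p i                        ≡⟨ count-< rp (<⇒≤ (bounded rp i)) ⟨
  count (λ j → p j <? p i)   ≡⟨ count-cong (λ j → p j <? p i) (λ j → q j <? q i)
                                  (λ _ → to) (λ _ → from) ⟩
  count (λ j → q j <? q i)   ≡⟨ count-< rq (<⇒≤ (bounded rq i)) ⟩
  q i                        ∎
  where open ≡-Reasoning

code≤tm : ∀ {n} {tm pos : Fin n → ℕ} → IsRanking tm → ∀ i → code tm pos i ≤ tm i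
code≤tm {tm = tm} {pos} rt i = ≤-trans
  (count-mono (below? tm pos i) (λ m → tm m <? tm i) (λ _ → proj₁))
  (≤-reflexive (count-< rt (<⇒≤ (bounded rt i))))

-- The code is at most the spot, so the `j` rows with spot below `j` also have a code below `j`.
code-parking : ∀ {n} {tm pos : Fin n → ℕ} → IsRanking tm → IsParking (code tm pos)
code-parking {n} {tm} {pos} rt {j} j≤n = begin
  count late? + j                             ≡⟨ cong (count late? +_) (count-< rt j≤n) ⟨
  count late? + count (λ i → tm i <? j)       ≤⟨ count-disjoint late? (λ i → tm i <? j)
                                                   (λ i j≤ tm< → <⇒≱ tm< (≤-trans j≤ (code≤tm rt i))) ⟩
  n                                           ∎
  where
  open ≤-Reasoning
  late? : Decidable (λ i → j ≤ code tm pos i)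
  late? i = j ≤? code tm pos i

-- Parking rule: the spot of i is the first spot from code i on that is not taken by a row above i.
spot-taken : ∀ {n} {tm pos : Fin n → ℕ} → IsRanking tm → Compatible tm pos →
  ∀ {i r} → code tm pos i ≤ tm r → tm r < tm i → r Fin.< i
spot-taken {tm = tm} {pos} rt compatible {i} {r} code≤ r<i with Fin.<-cmp r i
... | tri< lt _ _  = lt
... | tri≈ _ refl _ = contradiction r<i (<-irrefl refl)
... | tri> _ _ i<r = contradiction code≤ (<⇒≱ (begin-strict
  tm r                               <⟨ ≤-refl ⟩
  suc (tm r)                         ≡⟨ count-< rt (bounded rt r) ⟨
  count (λ m → tm m <? suc (tm r))   ≤⟨ count-mono (λ m → tm m <? suc (tm r)) (below? tm pos i)
    (λ m le → ≤-<-trans (s≤s⁻¹ le) r<i , compatible i<r r<i (s≤s⁻¹ le)) ⟩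
  code tm pos i                      ∎))
  where open ≤-Reasoning

module _ {n} {tm tm′ pos pos′ : Fin n → ℕ}
  (rt : IsRanking tm) (rt′ : IsRanking tm′)
  (compatible : Compatible tm pos)
  (codes : ∀ i → code tm pos i ≡ code tm′ pos′ i) where

  -- If `tm′ i < tm i`, the spot `tm′ i` is at least the common code of `i` and below `tm i`, so
  -- under `tm` a row above `i` takes it. That row has the same spot under `tm′`, where the spot
  -- belongs to `i`.
  not-later : ∀ i → (∀ {r} → r Fin.< i → tm r ≡ tm′ r) → ¬ tm′ i < tm i
  not-later i earlier lt with ranking-surjective rt (bounded rt′ i)
  ... | r , tm-r = Fin.<-irrefl (injective rt′ (trans (sym (earlier r<i)) tm-r)) r<i
    where
    r<i : r Fin.< i
    r<i = spot-taken rt compatible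
      (subst₂ _≤_ (sym (codes i)) (sym tm-r) (code≤tm rt′ i)) (subst (_< tm i) (sym tm-r) lt)

tm-unique : ∀ {n} {tm tm′ pos pos′ : Fin n → ℕ} → IsRanking tm → IsRanking tm′ →
  Compatible tm pos → Compatible tm′ pos′ →
  (∀ i → code tm pos i ≡ code tm′ pos′ i) → ∀ i → tm i ≡ tm′ i
tm-unique {tm = tm} {tm′} rt rt′ c c′ codes i = go i (<-wellFounded (toℕ i))
  where
  go : ∀ i → Acc _<_ (toℕ i) → tm i ≡ tm′ i
  go i (acc rec) = ≤-antisym
    (≮⇒≥ (not-later rt rt′ c codes i λ {r} lt → go r (rec lt)))
    (≮⇒≥ (not-later rt′ rt c′ (sym ∘ codes) i λ {r} lt → sym (go r (rec lt))))

-- Lehmer codes: when the rows are inserted in the order tm, the code prescribes the position of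
-- each new row.
module _ {n} {tm : Fin n → ℕ} (rt : IsRanking tm) where

  private
    SameOrder : (pos pos′ : Fin n → ℕ) → ℕ → Set
    SameOrder pos pos′ t = ∀ {i j} → tm i < t → tm j < t → pos i < pos j → pos′ i < pos′ j

    module _ {pos pos′ : Fin n → ℕ} (rp : IsRanking pos) (rp′ : IsRanking pos′)
      (codes : ∀ i → code tm pos i ≡ code tm pos′ i) {t}
      (to : SameOrder pos pos′ t) (from : SameOrder pos′ pos t) where

      flip< : ∀ {i j} → pos i < pos j → ¬ pos′ i < pos′ j → pos′ j < pos′ i
      flip< i<j ≮ = ≤∧≢⇒< (≮⇒≥ ≮) λ eq → <-irrefl (cong pos (sym (injective rp′ eq))) i<j

      -- A violation at the new row i would make one of the two sets counted by the codes a proper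
      -- subset of the other.
      new-left : ∀ {i m} → tm i ≡ t → tm m < t → pos m < pos i → pos′ m < pos′ i
      new-left {i} {m} refl m<t m<i = decidable-stable (pos′ m <? pos′ i) λ ≮ →
        <-irrefl (sym (codes i)) (count-strict (below? tm pos′ i) (below? tm pos i)
          (λ k (k<t , k<i) → k<t , <-trans (from k<t m<t (<-trans k<i (flip< m<i ≮))) m<i)
          (m<t , m<i) (≮ ∘ proj₂))

      new-right : ∀ {i m} → tm i ≡ t → tm m < t → pos i < pos m → pos′ i < pos′ m
      new-right {i} {m} refl m<t i<m = decidable-stable (pos′ i <? pos′ m) λ ≮ →
        <-irrefl (codes i) (count-strict (below? tm pos i) (below? tm pos′ i)
          (λ k (k<t , k<i) → k<t , <-trans (to k<t m<t (<-trans k<i i<m)) (flip< i<m ≮))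
          (m<t , flip< i<m ≮) (λ (_ , m<i) → <-asym i<m m<i))

      same-order-suc : SameOrder pos pos′ (suc t)
      same-order-suc {i} {j} (s≤s i≤t) (s≤s j≤t) lt with m≤n⇒m<n∨m≡n i≤t | m≤n⇒m<n∨m≡n j≤t
      ... | inj₁ i<t | inj₁ j<t = to i<t j<t lt
      ... | inj₁ i<t | inj₂ eq  = new-left eq i<t lt
      ... | inj₂ eq  | inj₁ j<t = new-right eq j<t lt
      ... | inj₂ eq  | inj₂ eq′ =
        contradiction lt (<-irrefl (cong pos (injective rt (trans eq (sym eq′)))))

  pos-unique : ∀ {pos pos′ : Fin n → ℕ} → IsRanking pos → IsRanking pos′ →
    (∀ i → code tm pos i ≡ code tm pos′ i) → ∀ i → pos i ≡ pos′ i
  pos-unique {pos} {pos′} rp rp′ codes = ranking-unique rp rp′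
    (proj₁ (same-order n) (bounded rt _) (bounded rt _))
    (proj₂ (same-order n) (bounded rt _) (bounded rt _))
    where
    same-order : ∀ t → SameOrder pos pos′ t × SameOrder pos′ pos t
    same-order zero = (λ ()) , (λ ())
    same-order (suc t) with same-order t
    ... | to , from = (λ {i} {j} → same-order-suc rp rp′ codes to from {i} {j})
                    , (λ {i} {j} → same-order-suc rp′ rp (sym ∘ codes) from to {i} {j})

code-injective : ∀ {n} {tm tm′ pos pos′ : Fin n → ℕ} → IsRanking tm → IsRanking tm′ →
  IsRanking pos → IsRanking pos′ → Compatible tm pos → Compatible tm′ pos′ →
  (∀ i → code tm pos i ≡ code tm′ pos′ i) → (∀ i → tm i ≡ tm′ i) × (∀ i → pos i ≡ pos′ i)
code-injective {tm = tm} {tm′} {pos} {pos′} rt rt′ rp rp′ c c′ codes =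
  tm≡ , pos-unique rt rp rp′ codes′
  where
  tm≡ : ∀ i → tm i ≡ tm′ i
  tm≡ = tm-unique rt rt′ c c′ codes
  codes′ : ∀ i → code tm pos i ≡ code tm pos′ i
  codes′ i = trans (codes i) (count-cong (below? tm′ pos′ i) (below? tm pos′ i)
    (λ m (p , q) → subst₂ _<_ (sym (tm≡ m)) (sym (tm≡ i)) p , q)
    (λ m (p , q) → subst₂ _<_ (tm≡ m) (tm≡ i) p , q))

-- Fillings and compatible pairs of rankings

opposite-< : ∀ {n} {i j : Fin n} → i Fin.< j → toℕ (opposite j) < toℕ (opposite i)
opposite-< {n} {i} {j} i<j = subst₂ _<_ (sym (Fin.opposite-prop j)) (sym (Fin.opposite-prop i))
  (∸-monoʳ-< (s≤s i<j) (Fin.toℕ<n j))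

opposite-<⁻ : ∀ {n} {i j : Fin n} → toℕ (opposite j) < toℕ (opposite i) → i Fin.< j
opposite-<⁻ {i = i} {j} lt =
  subst₂ Fin._<_ (Fin.opposite-involutive i) (Fin.opposite-involutive j) (opposite-< lt)

descent : ∀ {n} → Vec (Fin n) n → Fin n → ℕ
descent π i = toℕ (opposite (lookup π i))

descent-ranking : ∀ {n} (π : Vec (Fin n) n) → IsPerm π → IsRanking (descent π)
descent-ranking π perm = record
  { injective = λ eq → perm _ _ (trans (sym (Fin.opposite-involutive _))
      (trans (cong opposite (Fin.toℕ-injective eq)) (Fin.opposite-involutive _)))
  ; bounded = λ i → Fin.toℕ<n (opposite (lookup π i)) }

descent-surjective : ∀ {n} {key : Fin n → ℕ} → IsRanking key → ∃ λ π → ∀ i → descent π i ≡ key i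
descent-surjective {key = key} r = Vec.tabulate π , λ i → begin
  toℕ (opposite (lookup (Vec.tabulate π) i))          ≡⟨ cong (toℕ ∘ opposite) (Vec.lookup∘tabulate π i) ⟩
  toℕ (opposite (opposite (fromℕ< (bounded r i))))    ≡⟨ cong toℕ (Fin.opposite-involutive _) ⟩
  toℕ (fromℕ< (bounded r i))                          ≡⟨ Fin.toℕ-fromℕ< _ ⟩
  key i                                               ∎
  where
  open ≡-Reasoning
  π : _ → _
  π i = opposite (fromℕ< (bounded r i))

descent-injective : ∀ {n} (π π′ : Vec (Fin n) n) → (∀ i → descent π i ≡ descent π′ i) → π ≡ π′
descent-injective π π′ eqs = begin
  π                    ≡⟨ Vec.tabulate∘lookup π ⟨
  Vec.tabulate (lookup π)  ≡⟨ Vec.tabulate-cong (λ i → trans (sym (Fin.opposite-involutive _))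
                            (trans (cong opposite (Fin.toℕ-injective (eqs i)))
                              (Fin.opposite-involutive _))) ⟩
  Vec.tabulate (lookup π′) ≡⟨ Vec.tabulate∘lookup π′ ⟩
  π′                   ∎
  where open ≡-Reasoning

Realizable : ∀ {n} → Vec (Fin n) n → Vec (Fin n) n → Set
Realizable {n} π₁ π₂ = ∃ λ (τ : SPCT n) →
  IsStandardization (column (proj₁ τ) col₁) π₁ × IsStandardization (column (proj₁ τ) col₂) π₂

-- With `a`, `b` the entries of row `i` and `c` the column 2 entry of `r`, the hypothesis
-- `tm r < tm i` says `b < c`, so the triple condition forces `a < c`. A row `m` with `tm m ≤ tm r`
-- has a column 2 entry of at least `c`, hence a column 1 entry above `a`.
realizable⇒compatible : ∀ {n} (π₁ π₂ : Vec (Fin n) n) → Realizable π₁ π₂ →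
  Compatible (descent π₂) (descent π₁)
realizable⇒compatible π₁ π₂ ((τ , spct) , (_ , st₁) , (_ , st₂)) {i} {r} {m} i<r r<i m≤r =
  opposite-< (Equivalence.from (st₁ m i) (begin-strict
    toℕ (τ i col₁)  <⟨ ≰⇒> (λ c≤a → <-asym b<c (triple i r i<r c≤a)) ⟩
    toℕ (τ r col₂)  ≤⟨ ≮⇒≥ (λ lt → ≤⇒≯ m≤r (opposite-< (Equivalence.from (st₂ r m) lt))) ⟩
    toℕ (τ m col₂)  <⟨ rowsDec m ⟩
    toℕ (τ m col₁)  ∎))
  where
  open IsSPCT spct
  open ≤-Reasoning
  b<c : τ i col₂ Fin.< τ r col₂
  b<c = Equivalence.to (st₂ r i) (opposite-<⁻ r<i)

module _ {m} (key : Fin m → ℕ) where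

  private
    above : Fin m → ℕ
    above e = count (λ e′ → key e <? key e′)

    above-< : ∀ e → above e < m
    above-< e = subst (above e <_) (count-⊤ m)
      (count-strict (λ e′ → key e <? key e′) ⊤? (λ _ _ → tt) {e} tt (<-irrefl refl))

    above-antitone : ∀ {e e′} → key e < key e′ → above e′ < above e
    above-antitone {e} {e′} lt = count-strict (λ d → key e′ <? key d) (λ d → key e <? key d)
      (λ _ → <-trans lt) {e′} lt (<-irrefl refl)

  -- Turns keys into entries with the order reversed. Counting larger keys gives distinct entries as
  -- soon as the keys are distinct.
  descending-rank : Fin m → Fin m
  descending-rank e = fromℕ< (above-< e)

  descending-rank-< : ∀ {e e′} → key e < key e′ → descending-rank e′ Fin.< descending-rank e
  descending-rank-< {e} {e′} lt =
    subst₂ _<_ (sym (Fin.toℕ-fromℕ< (above-< e′))) (sym (Fin.toℕ-fromℕ< (above-< e)))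
      (above-antitone lt)

*-lex-< : ∀ {K a b c d} → a < b → c < K → a * K + c < b * K + d
*-lex-< {K} {a} {b} {c} {d} a<b c<K = begin-strict
  a * K + c  <⟨ +-monoʳ-< (a * K) c<K ⟩
  a * K + K  ≡⟨ +-comm (a * K) K ⟩
  suc a * K  ≤⟨ *-monoˡ-≤ K a<b ⟩
  b * K      ≤⟨ m≤m+n (b * K) d ⟩
  b * K + d  ∎
  where open ≤-Reasoning

*-lex-≤-< : ∀ K {a b c d} → a ≤ b → c < d → a * K + c < b * K + d
*-lex-≤-< K a≤b c<d = +-mono-≤-< (*-monoˡ-≤ K a≤b) c<d

module Realize {n} (tm pos : Fin n → ℕ) (rt : IsRanking tm) (rp : IsRanking pos)
  (compatible : Compatible tm pos) where

  -- The entry of r in column 2 goes directly below the lowest entry of column 1 belonging to a row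
  -- whose column 2 entry is at least that of r.
  abstract
    lowest : ∀ r → ∃ λ m → tm m ≤ tm r × (∀ {j} → tm j ≤ tm r → pos j ≤ pos m)
    -- Minimising `n ∸ pos m` maximises `pos m`.
    lowest r with minimal (λ m → tm m ≤? tm r) (λ m → n ∸ pos m) (r , ≤-refl)
    ... | m , le , least = m , le , λ q →
      ∸-cancelʳ-≤ (<⇒≤ (bounded rp _)) (least q)

  level : Fin n → ℕ
  level r = pos (proj₁ (lowest r))

  level-mono : ∀ {r s} → tm r ≤ tm s → level r ≤ level s
  level-mono {r} {s} le = proj₂ (proj₂ (lowest s)) (≤-trans (proj₁ (proj₂ (lowest r))) le)

  pos≤level : ∀ r → pos r ≤ level r
  pos≤level r = proj₂ (proj₂ (lowest r)) ≤-refl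

  K = suc n

  -- Lexicographic pairs in base `n + 1`, a smaller key standing for a larger entry. The last digit
  -- is `0` in column 1 and positive in column 2, so at each level the column 1 entry comes first
  -- and the column 2 entries follow in the order `tm`.
  key : Fin 2 → Fin n → ℕ
  key Fin.zero           i = pos i * K + 0
  key (Fin.suc Fin.zero) r = level r * K + suc (tm r)

  key₁-< : ∀ {i k} → pos i < pos k → key col₁ i < key col₁ k
  key₁-< lt = *-lex-< lt z<s

  key₂-< : ∀ {i k} → tm i < tm k → key col₂ i < key col₂ k
  key₂-< lt = *-lex-≤-< K (level-mono (<⇒≤ lt)) (s≤s lt)

  key₁<key₂ : ∀ {i k} → pos i ≤ level k → key col₁ i < key col₂ k
  key₁<key₂ le = *-lex-≤-< K le z<s

  key₂<key₁ : ∀ {i k} → level k < pos i → key col₂ k < key col₁ i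
  key₂<key₁ lt = *-lex-< lt (s≤s (bounded rt _))

  abstract
    τ : Filling n
    τ i j = descending-rank (uncurry key ∘ remQuot n) (combine j i)

    τ-< : ∀ {i j k l} → key j i < key l k → τ k l Fin.< τ i j
    τ-< {i} {j} {k} {l} lt = descending-rank-< (uncurry key ∘ remQuot n)
      (subst₂ (λ p q → uncurry key p < uncurry key q)
        (sym (Fin.remQuot-combine j i)) (sym (Fin.remQuot-combine l k)) lt)

  τ-≢ : ∀ {i j k l} → key j i < key l k → τ i j ≢ τ k l
  τ-≢ lt eq = Fin.<-irrefl (sym eq) (τ-< lt)

  cross : ∀ i k → τ i col₁ ≢ τ k col₂
  cross i k with pos i ≤? level k
  ... | yes le = τ-≢ (key₁<key₂ le)
  ... | no ¬le = λ eq → τ-≢ {k} {col₂} {i} {col₁} (key₂<key₁ (≰⇒> ¬le)) (sym eq)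

  same-column : ∀ j {p : Fin n → ℕ} → IsRanking p → (∀ {i k} → p i < p k → key j i < key j k) →
    ∀ {i k} → τ i j ≡ τ k j → i ≡ k
  same-column j {p} r mono {i} {k} eq with <-cmp (p i) (p k)
  ... | tri< lt _ _ = contradiction eq (τ-≢ (mono lt))
  ... | tri≈ _ p≡ _ = injective r p≡
  ... | tri> _ _ gt = contradiction (sym eq) (τ-≢ (mono gt))

  distinct : Distinct τ
  distinct i Fin.zero k Fin.zero eq = same-column col₁ rp key₁-< eq , refl
  distinct i Fin.zero k (Fin.suc Fin.zero) eq = contradiction eq (cross i k)
  distinct i (Fin.suc Fin.zero) k Fin.zero eq = contradiction (sym eq) (cross k i)
  distinct i (Fin.suc Fin.zero) k (Fin.suc Fin.zero) eq = same-column col₂ rt key₂-< eq , refl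

  -- If `tm r < tm i`, compatibility applied to the lowest row for `r` puts the level of `r` before
  -- `pos i`, so `c > a` and the premise fails. If `tm i < tm r`, the conclusion is the order of
  -- column 2.
  triple : TripleCondition τ
  triple i r i<r c≤a with <-cmp (tm i) (tm r)
  ... | tri< lt _ _ = τ-< (key₂-< lt)
  ... | tri≈ _ eq _ = contradiction i<r (Fin.<-irrefl (injective rt eq))
  ... | tri> _ _ gt = contradiction c≤a (<⇒≱ (τ-< (key₂<key₁
    (compatible i<r gt (proj₁ (proj₂ (lowest r)))))))

  spct : SPCT n
  spct = τ , record
    { distinct = distinct ; rowsDec = λ i → τ-< (key₁<key₂ (pos≤level i)) ; triple = triple }

  standardization : ∀ j {p : Fin n → ℕ} → IsRanking p →
    (∀ {i k} → p i < p k → key j i < key j k) →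
    ∀ π → (∀ i → descent π i ≡ p i) → IsStandardization (column τ j) π
  standardization j {p} r mono π eqs =
    (λ i k eq → injective r (trans (sym (eqs i)) (trans (cong (toℕ ∘ opposite) eq) (eqs k)))) ,
    λ i k → mk⇔
      (λ lt → τ-< (mono (subst₂ _<_ (eqs i) (eqs k) (opposite-< lt))))
      (λ lt → opposite-<⁻ (subst₂ _<_ (sym (eqs i)) (sym (eqs k)) (reflect lt)))
    where
    reflect : ∀ {i k} → τ k j Fin.< τ i j → p i < p k
    reflect {i} {k} lt with <-cmp (p i) (p k)
    ... | tri< i<k _ _ = i<k
    ... | tri≈ _ p≡ _  = contradiction lt (Fin.<-irrefl (cong (λ i → τ i j) (sym (injective r p≡))))
    ... | tri> _ _ k<i = contradiction lt (Fin.<-asym (τ-< (mono k<i)))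

  realizable : ∀ π₁ π₂ → (∀ i → descent π₁ i ≡ pos i) → (∀ i → descent π₂ i ≡ tm i) →
    Realizable π₁ π₂
  realizable π₁ π₂ eqs₁ eqs₂ =
    spct , standardization col₁ rp key₁-< π₁ eqs₁ , standardization col₂ rt key₂-< π₂ eqs₂

-- Trees and words of sibling sets

module _ {A : Set} where

  -- A tree is read as a rooted forest: the right spine lists the siblings, and the left subtree of a
  -- sibling is the forest of its children. The word of a tree lists its sibling sets in preorder.
  spine : BTree A → List A
  spine leaf         = []
  spine (node l x r) = x ∷ spine r

  mutual
    word : BTree A → List (List A)
    word t = spine t ∷ children t

    children : BTree A → List (List A)
    children leaf         = []
    children (node l x r) = word l ++ children r

  leftSubtrees : BTree A → List (BTree A)
  leftSubtrees leaf         = []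
  leftSubtrees (node l x r) = l ∷ leftSubtrees r

  graft : BTree A → A → List (BTree A) → List (BTree A)
  graft l x []       = []
  graft l x (r ∷ ts) = node l x r ∷ ts

  -- attach xs pops the left subtrees of the labels xs off a stack of trees and pushes the tree with
  -- spine xs. On a stack shorter than xs it returns a junk value.
  attach : List A → List (BTree A) → List (BTree A)
  attach []       ts       = leaf ∷ ts
  attach (x ∷ xs) []       = []
  attach (x ∷ xs) (l ∷ ts) = graft l x (attach xs ts)

  parse : List (List A) → List (BTree A)
  parse = foldr attach []

  attach-spine : ∀ t ts → attach (spine t) (leftSubtrees t ++ ts) ≡ t ∷ ts
  attach-spine leaf         ts = refl
  attach-spine (node l x r) ts = cong (graft l x) (attach-spine r ts)

  -- The stack invariant: once the sets below the spine of `t` are read, the left subtrees along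
  -- that spine lie on top of the stack, ready for `attach (spine t)`.
  parse-children : ∀ t w → parse (children t ++ w) ≡ leftSubtrees t ++ parse w
  parse-children leaf w = refl
  parse-children (node l x r) w = begin
    attach (spine l) (parse ((children l ++ children r) ++ w))
      ≡⟨ cong (attach (spine l) ∘ parse) (++-assoc (children l) (children r) w) ⟩
    attach (spine l) (parse (children l ++ (children r ++ w)))
      ≡⟨ cong (attach (spine l)) (parse-children l (children r ++ w)) ⟩
    attach (spine l) (leftSubtrees l ++ parse (children r ++ w))
      ≡⟨ attach-spine l _ ⟩
    l ∷ parse (children r ++ w)
      ≡⟨ cong (l ∷_) (parse-children r w) ⟩
    l ∷ leftSubtrees r ++ parse w ∎
    where open ≡-Reasoning

  parse-word : ∀ t w → parse (word t ++ w) ≡ t ∷ parse w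
  parse-word t w = trans (cong (attach (spine t)) (parse-children t w)) (attach-spine t (parse w))

  word-injective : ∀ {t t′} → word t ≡ word t′ → t ≡ t′
  word-injective {t} {t′} eq = proj₁ (∷-injective (begin
    t ∷ parse []          ≡⟨ parse-word t [] ⟨
    parse (word t ++ [])  ≡⟨ cong (λ w → parse (w ++ [])) eq ⟩
    parse (word t′ ++ []) ≡⟨ parse-word t′ [] ⟩
    t′ ∷ parse []         ∎))
    where open ≡-Reasoning

  total : List (List A) → ℕ
  total w = length (concat w)

  -- Each set pushes one tree and pops one per label, so reading the suffix `w` leaves
  -- `length w - total w` trees. The condition says that these suffice for `xs`.
  Ballot : List (List A) → Set
  Ballot []       = ⊤
  Ballot (xs ∷ w) = total (xs ∷ w) ≤ length w × Ballot w

  total-∷ : ∀ xs w → total (xs ∷ w) ≡ length xs + total w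
  total-∷ xs w = length-++ xs

  total-++ : ∀ u v → total (u ++ v) ≡ total u + total v
  total-++ u v = trans (cong length (sym (concat-++ u v))) (length-++ (concat u))

  word-attach : ∀ xs ts → length xs ≤ length ts → ∃₂ λ t ts′ →
    attach xs ts ≡ t ∷ ts′ × concatMap word (t ∷ ts′) ≡ xs ∷ concatMap word ts ×
    length ts′ + length xs ≡ length ts
  word-attach [] ts _ = leaf , ts , refl , refl , +-identityʳ _
  word-attach (x ∷ xs) (l ∷ ts) (s≤s le) with word-attach xs ts le
  ... | r , ts′ , eq , words , len =
    node l x r , ts′ , cong (graft l x) eq , words′ , trans (+-suc _ _) (cong suc len)
    where
    words′ : concatMap word (node l x r ∷ ts′) ≡ (x ∷ xs) ∷ concatMap word (l ∷ ts)
    words′ = cong₂ (λ s w → (x ∷ s) ∷ w) (proj₁ (∷-injective words)) (begin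
      (word l ++ children r) ++ concatMap word ts′  ≡⟨ ++-assoc (word l) (children r) _ ⟩
      word l ++ (children r ++ concatMap word ts′)  ≡⟨ cong (word l ++_) (proj₂ (∷-injective words)) ⟩
      word l ++ concatMap word ts                   ∎)
      where open ≡-Reasoning

  word-parse : ∀ w → Ballot w → concatMap word (parse w) ≡ w × length (parse w) + total w ≡ length w
  word-parse [] _ = refl , refl
  word-parse (xs ∷ w) (le , ballot) with word-parse w ballot
  ... | words , len with word-attach xs (parse w) (+-cancelʳ-≤ (total w) _ _ (begin
    length xs + total w          ≡⟨ total-∷ xs w ⟨
    total (xs ∷ w)               ≤⟨ le ⟩
    length w                     ≡⟨ len ⟨
    length (parse w) + total w   ∎))
    where open ≤-Reasoning
  ...   | t , ts , eq , words′ , len′ =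
    trans (cong (concatMap word) eq) (trans words′ (cong (xs ∷_) words)) , (begin
      length (attach xs (parse w)) + total (xs ∷ w)  ≡⟨ cong₂ _+_ (cong length eq) (total-∷ xs w) ⟩
      suc (length ts) + (length xs + total w)        ≡⟨ cong suc (sym (+-assoc (length ts) (length xs) _)) ⟩
      suc (length ts + length xs + total w)          ≡⟨ cong (λ m → suc (m + total w)) len′ ⟩
      suc (length (parse w) + total w)               ≡⟨ cong suc len ⟩
      suc (length w)                                 ∎)
    where open ≡-Reasoning

  -- The final stack holds `length w - total w` trees, which is exactly one.
  word-surjective : ∀ w → Ballot w → suc (total w) ≡ length w → ∃ λ t → word t ≡ w
  word-surjective w ballot full with parse w | word-parse w ballot
  ... | []          | _ , len = contradiction (trans full (sym len)) 1+n≢n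
  ... | t ∷ []      | words , _ = t , trans (sym (++-identityʳ (word t))) words
  ... | t ∷ u ∷ ts | _ , len = contradiction (trans len (sym full)) (<⇒≢ (s≤s (s≤s (m≤n+m _ _))) ∘ sym)

  -- Labels, sizes and the ballot property of tree words

  labels : BTree A → List A
  labels leaf         = []
  labels (node l x r) = x ∷ labels l ++ labels r

  word↭labels : ∀ t → concat (word t) ↭ labels t
  word↭labels leaf = ↭-reflexive refl
  word↭labels (node l x r) = prep x (↭-trans
    (↭-reflexive (cong (spine r ++_) (sym (concat-++ (word l) (children r)))))
    (↭-trans (shifts (spine r) (concat (word l))) (↭-++⁺ (word↭labels l) (word↭labels r))))

  length-labels : ∀ t → length (labels t) ≡ size t
  length-labels leaf = refl
  length-labels (node l x r) = cong suc
    (trans (length-++ (labels l)) (cong₂ _+_ (length-labels l) (length-labels r)))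

  total-word : ∀ t → total (word t) ≡ size t
  total-word t = trans (↭-length (word↭labels t)) (length-labels t)

  -- Every node contributes exactly one set, that of its own children, possibly empty. A word
  -- therefore has one set more than the tree has nodes.
  length-children : ∀ t → length (children t) ≡ size t
  length-children leaf = refl
  length-children (node l x r) = cong suc
    (trans (length-++ (children l)) (cong₂ _+_ (length-children l) (length-children r)))

  ballot-≤ : ∀ w → Ballot w → total w ≤ length w
  ballot-≤ []      _        = z≤n
  ballot-≤ (xs ∷ w) (le , _) = m≤n⇒m≤1+n le

  ballot-++ : ∀ u v → Ballot u → Ballot v → Ballot (u ++ v)
  ballot-++ []       v _        bv = bv
  ballot-++ (xs ∷ u) v (le , bu) bv = (begin
    total (xs ∷ u ++ v)          ≡⟨ total-++ (xs ∷ u) v ⟩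
    total (xs ∷ u) + total v     ≤⟨ +-mono-≤ le (ballot-≤ v bv) ⟩
    length u + length v          ≡⟨ length-++ u ⟨
    length (u ++ v)              ∎) , ballot-++ u v bu bv
    where open ≤-Reasoning

  mutual
    ballot-word : ∀ t → Ballot (word t)
    ballot-word t = ≤-reflexive (trans (total-word t) (sym (length-children t))) , ballot-children t

    ballot-children : ∀ t → Ballot (children t)
    ballot-children leaf = tt
    ballot-children (node l x r) = ballot-++ (word l) (children r) (ballot-word l) (ballot-children r)

  ballot-drop : ∀ w j → Ballot w → j < length w → total (drop j w) + j < length w
  ballot-drop (xs ∷ w) zero    (le , _) _ = s≤s (≤-trans (≤-reflexive (+-identityʳ _)) le)
  ballot-drop (xs ∷ w) (suc j) (_ , b) (s≤s lt) =
    subst (_< suc (length w)) (sym (+-suc _ j)) (s≤s (ballot-drop w j b lt))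

  unique-++⁻ : ∀ (xs : List A) {ys} → Unique (xs ++ ys) → Unique xs × Unique ys × Disjoint xs ys
  unique-++⁻ [] u = [] , u , λ ()
  unique-++⁻ (x ∷ xs) (x∉ ∷ u) with unique-++⁻ xs u
  ... | ux , uy , dis = All.++⁻ˡ xs x∉ ∷ ux , uy , λ where
    (here refl , y∈) → All.lookup (All.++⁻ʳ xs x∉) y∈ refl
    (there x∈ , y∈)  → dis (x∈ , y∈)

  ∈T⇒∈labels : ∀ {x : A} {t} → x ∈T t → x ∈ labels t
  ∈T⇒∈labels here = here refl
  ∈T⇒∈labels (left p) = there (∈-++⁺ˡ (∈T⇒∈labels p))
  ∈T⇒∈labels (right {l} p) = there (∈-++⁺ʳ (labels l) (∈T⇒∈labels p))

  ∈labels⇒∈T : ∀ {x : A} t → x ∈ labels t → x ∈T t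
  ∈labels⇒∈T (node l x r) (here refl) = here
  ∈labels⇒∈T (node l x r) (there p) with ∈-++⁻ (labels l) p
  ... | inj₁ q = left (∈labels⇒∈T l q)
  ... | inj₂ q = right (∈labels⇒∈T r q)

  distinct⇒unique : ∀ {t} → DistinctLabels t → Unique (labels t)
  distinct⇒unique leaf = []
  distinct⇒unique {node l x r} (node dl dr x∉l x∉r dis) =
    All.tabulate (λ where y∈ refl → x∉ (∈-++⁻ (labels l) y∈)) ∷
    Unique.++⁺ (distinct⇒unique dl) (distinct⇒unique dr)
      (λ (p , q) → dis (∈labels⇒∈T l p) (∈labels⇒∈T r q))
    where
    x∉ : x ∈ labels l ⊎ x ∈ labels r → ⊥
    x∉ (inj₁ p) = x∉l (∈labels⇒∈T l p)
    x∉ (inj₂ p) = x∉r (∈labels⇒∈T r p)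

  unique⇒distinct : ∀ t → Unique (labels t) → DistinctLabels t
  unique⇒distinct leaf _ = leaf
  unique⇒distinct (node l x r) (x∉ ∷ u) with unique-++⁻ (labels l) u
  ... | ul , ur , dis = node (unique⇒distinct l ul) (unique⇒distinct r ur)
    (λ p → All.lookup x∉ (∈-++⁺ˡ (∈T⇒∈labels p)) refl)
    (λ p → All.lookup x∉ (∈-++⁺ʳ (labels l) (∈T⇒∈labels p)) refl)
    (λ p q → dis (∈T⇒∈labels p , ∈T⇒∈labels q))

-- Descending sibling sets

Descending : ∀ {n} → List (Fin n) → Set
Descending = AllPairs Fin._>_

-- Distinctness turns the absence of right ascents into a strict descent along every right spine, so
-- each sibling set appears in its only descending listing.
noRA⇒descending : ∀ {n} (t : BTree (Fin n)) → NoRightAscent t → DistinctLabels t →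
  All Descending (word t)
noRA⇒descending leaf _ _ = [] ∷ []
noRA⇒descending (node l x leaf) noRA (node dl _ _ _ _) =
  ([] ∷ []) ∷ All.++⁺ (noRA⇒descending l noRA dl) []
noRA⇒descending (node l x r@(node rl y rr)) (x≮y , noRAl , noRAr) (node dl dr _ x∉r _)
  with noRA⇒descending r noRAr dr
... | (y> ∷ desc) ∷ rest =
  ((y<x ∷ All.map (λ z<y → <-trans z<y y<x) y>) ∷ y> ∷ desc) ∷
  All.++⁺ (noRA⇒descending l noRAl dl) rest
  where
  y<x : y Fin.< x
  y<x = ≤∧≢⇒< (≮⇒≥ x≮y) λ eq → x∉r (subst (_∈T r) (Fin.toℕ-injective eq) here)

descending⇒noRA : ∀ {n} (t : BTree (Fin n)) → All Descending (word t) → NoRightAscent t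
descending⇒noRA leaf _ = tt
descending⇒noRA (node l x leaf) (_ ∷ ds) = descending⇒noRA l (All.++⁻ˡ (word l) ds)
descending⇒noRA (node l x r@(node rl y rr)) (((y<x ∷ _) ∷ desc) ∷ ds) =
  <-asym y<x , descending⇒noRA l (All.++⁻ˡ (word l) ds) ,
  descending⇒noRA r (desc ∷ All.++⁻ʳ (word l) ds)

-- Sibling-set numbers of labels

_∈?_ : ∀ {n} (x : Fin n) (xs : List (Fin n)) → Dec (x ∈ xs)
x ∈? xs = any? (x Fin.≟_) xs

module _ {n : ℕ} where

  -- A label in none of the sets gets the value `length w`. This is why `_⊑_` below records
  -- membership along with the slot.
  slot : Fin n → List (List (Fin n)) → ℕ
  slot x []       = 0
  slot x (xs ∷ w) with x ∈? xs
  ... | yes _ = 0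
  ... | no  _ = suc (slot x w)

  slot-here : ∀ {x xs} w → x ∈ xs → slot x (xs ∷ w) ≡ 0
  slot-here {x} {xs} w x∈ with x ∈? xs
  ... | yes _  = refl
  ... | no  x∉ = contradiction x∈ x∉

  slot-there : ∀ {x xs} w → x ∉ xs → slot x (xs ∷ w) ≡ suc (slot x w)
  slot-there {x} {xs} w x∉ with x ∈? xs
  ... | yes x∈ = contradiction x∈ x∉
  ... | no  _  = refl

  slot≡0 : ∀ {x xs} w → slot x (xs ∷ w) ≡ 0 → x ∈ xs
  slot≡0 {x} {xs} w eq with x ∈? xs
  ... | yes x∈ = x∈

  slot-drop : ∀ {x} w {j} → x ∈ concat w → j ≤ slot x w → x ∈ concat (drop j w)
  slot-drop w {zero} x∈ _ = x∈
  slot-drop {x} (xs ∷ w) {suc j} x∈ j≤ with x ∈? xs | ∈-++⁻ xs x∈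
  slot-drop {x} (xs ∷ w) {suc j} x∈ (s≤s j≤) | no x∉ | inj₁ x∈xs = contradiction x∈xs x∉
  slot-drop {x} (xs ∷ w) {suc j} x∈ (s≤s j≤) | no x∉ | inj₂ x∈w  = slot-drop w x∈w j≤

  count-∈≤length : ∀ xs → count {n} (_∈? xs) ≤ length xs
  count-∈≤length [] = ≤-trans (count-mono {n} (_∈? []) ⊥? λ _ ()) (≤-reflexive (count-⊥ n))
  count-∈≤length (x ∷ xs) = begin
    count (_∈? (x ∷ xs))                    ≡⟨ +-count-⊥ n _ ⟨
    count (_∈? (x ∷ xs)) + count {n} ⊥?     ≤⟨ count-modular (_∈? (x ∷ xs)) ⊥? (Fin._≟ x) (_∈? xs)
                                                 (λ i → [ split , (λ ()) ]) (λ _ _ ()) ⟩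
    count (Fin._≟ x) + count (_∈? xs)       ≤⟨ +-mono-≤
      (count-subsingleton (Fin._≟ x) λ p q → trans p (sym q)) (count-∈≤length xs) ⟩
    suc (length xs)                         ∎
    where
    open ≤-Reasoning
    split : ∀ {i} → i ∈ x ∷ xs → i ≡ x ⊎ i ∈ xs
    split (here eq) = inj₁ eq
    split (there p) = inj₂ p

  length≤count-∈ : ∀ {xs} → Unique xs → length xs ≤ count {n} (_∈? xs)
  length≤count-∈ [] = z≤n
  length≤count-∈ {x ∷ xs} (x∉ ∷ u) = ≤-<-trans (length≤count-∈ u)
    (count-strict (_∈? xs) (_∈? (x ∷ xs)) (λ _ → there) {x} (here refl) λ x∈ → All.lookup x∉ x∈ refl)

  full⇒∈ : ∀ {xs} → Unique xs → n ≤ length xs → ∀ x → x ∈ xs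
  full⇒∈ {xs} u n≤ x = decidable-stable (x ∈? xs) λ x∉ → <-irrefl refl (begin-strict
    n                ≤⟨ n≤ ⟩
    length xs        ≤⟨ length≤count-∈ u ⟩
    count (_∈? xs)   <⟨ count-strict (_∈? xs) ⊤? (λ _ _ → tt) {x} tt x∉ ⟩
    count {n} ⊤?     ≡⟨ count-⊤ n ⟩
    n                ∎)
    where open ≤-Reasoning

  -- The labels with slot at least `j` all lie in the suffix `drop j w`, and the ballot condition
  -- leaves that suffix at most `n - j` labels.
  slot-parking : ∀ w → Ballot w → length w ≡ suc n → (∀ x → x ∈ concat w) →
    IsParking (λ x → slot x w)
  slot-parking w ballot len all {j} j≤n = s≤s⁻¹ (begin-strict
    count (λ x → j ≤? slot x w) + j          ≤⟨ +-monoˡ-≤ j (count-mono (λ x → j ≤? slot x w)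
                                                  (_∈? concat (drop j w)) (λ x → slot-drop w (all x))) ⟩
    count (_∈? concat (drop j w)) + j   ≤⟨ +-monoˡ-≤ j (count-∈≤length (concat (drop j w))) ⟩
    total (drop j w) + j                <⟨ ballot-drop w j ballot (subst (j <_) (sym len) (s≤s j≤n)) ⟩
    length w                                 ≡⟨ len ⟩
    suc n                                    ∎)
    where open ≤-Reasoning

  -- Both heads are the maximum of the same set.
  descending-unique : ∀ {xs ys : List (Fin n)} → Descending xs → Descending ys →
    (∀ {x} → x ∈ xs → x ∈ ys) → (∀ {x} → x ∈ ys → x ∈ xs) → xs ≡ ys
  descending-unique [] [] _ _ = refl
  descending-unique [] (_ ∷ _) _ from with () ← from (here refl)
  descending-unique (_ ∷ _) [] to _ with () ← to (here refl)
  descending-unique {x ∷ xs} {y ∷ ys} (x> ∷ dx) (y> ∷ dy) to from =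
    cong₂ _∷_ x≡y (descending-unique dx dy
      (λ p → tail (to (there p)) (λ { refl → Fin.<-irrefl (sym x≡y) (All.lookup x> p) }))
      (λ p → tail (from (there p)) (λ { refl → Fin.<-irrefl x≡y (All.lookup y> p) })))
    where
    tail : ∀ {z v} {vs : List (Fin n)} → z ∈ v ∷ vs → z ≢ v → z ∈ vs
    tail (here eq) z≢v = contradiction eq z≢v
    tail (there p) _   = p
    x≡y : x ≡ y
    x≡y with to (here refl) | from (here refl)
    ... | here eq | _       = eq
    ... | _       | here eq = sym eq
    ... | there p | there q = contradiction (All.lookup x> q) (<-asym (All.lookup y> p))

  record WellFormed (w : List (List (Fin n))) : Set where
    field
      descending : All Descending w
      unique     : Unique (concat w)

  _⊑_ : List (List (Fin n)) → List (List (Fin n)) → Set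
  w ⊑ w′ = ∀ {x} → x ∈ concat w → x ∈ concat w′ × slot x w ≡ slot x w′

  ⊑-head : ∀ {xs ys w w′} → (xs ∷ w) ⊑ (ys ∷ w′) → ∀ {x} → x ∈ xs → x ∈ ys
  ⊑-head {w = w} {w′} le x∈ =
    slot≡0 w′ (trans (sym (proj₂ (le (∈-++⁺ˡ x∈)))) (slot-here w x∈))

  ⊑-tail : ∀ {xs w w′} → Unique (xs ++ concat w) → (xs ∷ w) ⊑ (xs ∷ w′) → w ⊑ w′
  ⊑-tail {xs} {w} {w′} u le {x} x∈ with ∈-++⁻ xs (proj₁ (le (∈-++⁺ʳ xs x∈)))
  ... | inj₁ x∈xs = contradiction (x∈xs , x∈) (proj₂ (proj₂ (unique-++⁻ xs u)))
  ... | inj₂ x∈w′ = x∈w′ , suc-injective (begin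
      suc (slot x w)     ≡⟨ slot-there w x∉xs ⟨
      slot x (xs ∷ w)    ≡⟨ proj₂ (le (∈-++⁺ʳ xs x∈)) ⟩
      slot x (xs ∷ w′)   ≡⟨ slot-there w′ x∉xs ⟩
      suc (slot x w′)    ∎)
    where
    open ≡-Reasoning
    x∉xs : x ∉ xs
    x∉xs x∈xs = proj₂ (proj₂ (unique-++⁻ xs u)) (x∈xs , x∈)

  ⊑-antisym : ∀ {w w′} → length w ≡ length w′ → WellFormed w → WellFormed w′ →
    w ⊑ w′ → w′ ⊑ w → w ≡ w′
  ⊑-antisym {[]} {[]} _ _ _ _ _ = refl
  ⊑-antisym {xs ∷ w} {ys ∷ w′} len
    record { descending = dx ∷ dw ; unique = u } record { descending = dy ∷ dw′ ; unique = u′ } le ge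
    with descending-unique dx dy (⊑-head {w = w} {w′} le) (⊑-head {w = w′} {w} ge)
  ... | refl = cong (xs ∷_) (⊑-antisym (suc-injective len)
    record { descending = dw ; unique = proj₁ (proj₂ (unique-++⁻ xs u)) }
    record { descending = dw′ ; unique = proj₁ (proj₂ (unique-++⁻ xs u′)) }
    (⊑-tail {w = w} {w′} u le) (⊑-tail {w = w′} {w} u′ ge))

  -- Words built from parking functions

  module _ (f : Fin n → ℕ) where

    -- `tabulate opposite` lists all labels in descending order, and filtering keeps that order.
    block : ℕ → List (Fin n)
    block j = filter (λ x → f x ≟ j) (tabulate opposite)

    -- Used with `j = 0` and `k = n + 1`: one set for the roots and one for the children of each
    -- node. The last block is empty when `f` is parking.
    blocks : ℕ → ℕ → List (List (Fin n))
    blocks j zero    = []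
    blocks j (suc k) = block j ∷ blocks (suc j) k

    ∈-block⁺ : ∀ {x j} → f x ≡ j → x ∈ block j
    ∈-block⁺ {x} eq = ∈-filter⁺ (λ x → f x ≟ _)
      (subst (_∈ tabulate opposite) (Fin.opposite-involutive x) (∈-tabulate⁺ (opposite x))) eq

    ∈-block⁻ : ∀ {x j} → x ∈ block j → f x ≡ j
    ∈-block⁻ {j = j} x∈ = proj₂ (∈-filter⁻ (λ x → f x ≟ j) {xs = tabulate opposite} x∈)

    block-descending : ∀ j → Descending (block j)
    block-descending j = AllPairs.filter⁺ (λ x → f x ≟ j)
      (AllPairs.tabulate⁺-< {n = n} {f = opposite} λ {i} {k} i<k →
        subst₂ _<_ (sym (Fin.opposite-prop k)) (sym (Fin.opposite-prop i))
          (∸-monoʳ-< (s≤s i<k) (Fin.toℕ<n k)))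

    descending⇒unique : ∀ {xs : List (Fin n)} → Descending xs → Unique xs
    descending⇒unique = AllPairs.map λ x>y eq → Fin.<-irrefl (sym eq) x>y

    ∈-blocks⁻ : ∀ j k {x} → x ∈ concat (blocks j k) → j ≤ f x
    ∈-blocks⁻ j (suc k) x∈ with ∈-++⁻ (block j) x∈
    ... | inj₁ p = ≤-reflexive (sym (∈-block⁻ p))
    ... | inj₂ p = <⇒≤ (∈-blocks⁻ (suc j) k p)

    ∈-blocks⁺ : ∀ j k {x} → j ≤ f x → f x < j + k →
      x ∈ concat (blocks j k) × j + slot x (blocks j k) ≡ f x
    ∈-blocks⁺ j zero j≤ <j =
      contradiction (≤-<-trans j≤ (subst (f _ <_) (+-identityʳ j) <j)) (<-irrefl refl)
    ∈-blocks⁺ j (suc k) {x} j≤ <jk with m≤n⇒m<n∨m≡n j≤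
    ... | inj₂ refl = ∈-++⁺ˡ (∈-block⁺ refl) ,
      trans (cong (j +_) (slot-here (blocks (suc j) k) (∈-block⁺ refl))) (+-identityʳ j)
    ... | inj₁ j< with ∈-blocks⁺ (suc j) k j< (subst (f x <_) (+-suc j k) <jk)
    ...   | x∈ , eq = ∈-++⁺ʳ (block j) x∈ , trans
      (cong (j +_) (slot-there (blocks (suc j) k) λ p → <-irrefl (sym (∈-block⁻ p)) j<))
      (trans (+-suc j _) eq)

    length-blocks : ∀ j k → length (blocks j k) ≡ k
    length-blocks j zero    = refl
    length-blocks j (suc k) = cong suc (length-blocks (suc j) k)

    blocks-wellFormed : ∀ j k → WellFormed (blocks j k)
    blocks-wellFormed j zero = record { descending = [] ; unique = [] }
    blocks-wellFormed j (suc k) = record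
      { descending = block-descending j ∷ WellFormed.descending ih
      ; unique = Unique.++⁺ (descending⇒unique (block-descending j)) (WellFormed.unique ih)
          λ (p , q) → <-irrefl (sym (∈-block⁻ p)) (∈-blocks⁻ (suc j) k q) }
      where ih = blocks-wellFormed (suc j) k

    module _ (pf : IsParking f) where

      total-blocks : ∀ j k → j ≤ n → total (blocks j k) + j ≤ n
      total-blocks j k j≤n = begin
        total (blocks j k) + j
          ≤⟨ +-monoˡ-≤ j (length≤count-∈ (WellFormed.unique (blocks-wellFormed j k))) ⟩
        count (_∈? concat (blocks j k)) + j       ≤⟨ +-monoˡ-≤ j (count-mono (_∈? concat (blocks j k))
                                                       (λ x → j ≤? f x) (λ _ → ∈-blocks⁻ j k)) ⟩
        count (λ x → j ≤? f x) + j                ≤⟨ pf j≤n ⟩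
        n                                         ∎
        where open ≤-Reasoning

      -- By parking, at most `n - j` labels have value `j` or more, and exactly `n - j` blocks
      -- follow block `j`.
      blocks-ballot : ∀ j k → j + k ≡ suc n → Ballot (blocks j k)
      blocks-ballot j zero    _  = tt
      blocks-ballot j (suc k) eq = +-cancelʳ-≤ j _ _ (begin
        total (blocks j (suc k)) + j          ≤⟨ total-blocks j (suc k) (subst (j ≤_) j+k≡n (m≤m+n j k)) ⟩
        n                                     ≡⟨ j+k≡n ⟨
        j + k                                 ≡⟨ +-comm j k ⟩
        k + j                                 ≡⟨ cong (_+ j) (length-blocks (suc j) k) ⟨
        length (blocks (suc j) k) + j         ∎) , blocks-ballot (suc j) k (trans (sym (+-suc j k)) eq)
        where
        open ≤-Reasoning
        j+k≡n : j + k ≡ n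
        j+k≡n = suc-injective (trans (sym (+-suc j k)) eq)

      ∈-blocks : ∀ x → x ∈ concat (blocks 0 (suc n)) × slot x (blocks 0 (suc n)) ≡ f x
      ∈-blocks x = ∈-blocks⁺ 0 (suc n) z≤n (m≤n⇒m≤1+n (parking-< f pf x))

      total-all : total (blocks 0 (suc n)) ≡ n
      total-all = ≤-antisym
        (subst (_≤ n) (+-identityʳ _) (total-blocks 0 (suc n) z≤n))
        (begin
          n                                            ≡⟨ count-⊤ n ⟨
          count {n} ⊤?
            ≤⟨ count-mono ⊤? (_∈? concat (blocks 0 (suc n))) (λ x _ → proj₁ (∈-blocks x)) ⟩
          count (_∈? concat (blocks 0 (suc n)))        ≤⟨ count-∈≤length (concat (blocks 0 (suc n))) ⟩
          total (blocks 0 (suc n))                     ∎)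
        where open ≤-Reasoning

labelSlot : ∀ {n} → BTree (Fin n) → Fin n → ℕ
labelSlot t x = slot x (word t)

unique-resp-↭ : ∀ {n} {xs ys : List (Fin n)} → xs ↭ ys → Unique xs → Unique ys
unique-resp-↭ p = Unique-resp-↭ (setoid _) (↭⇒↭ₛ p)

module _ {n} {t : BTree (Fin n)} (valid : IsLabeledBTNoRA n t) where
  open IsLabeledBTNoRA valid

  word-wellFormed : WellFormed (word t)
  word-wellFormed = record
    { descending = noRA⇒descending t noRA distinct
    ; unique = unique-resp-↭ (↭-sym (word↭labels t)) (distinct⇒unique distinct) }

  length-word : length (word t) ≡ suc n
  length-word = cong suc (trans (length-children t) sizeN)

  ∈-word : ∀ x → x ∈ concat (word t)
  ∈-word = full⇒∈ (WellFormed.unique word-wellFormed)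
    (≤-reflexive (sym (trans (total-word t) sizeN)))

  labelSlot-parking : IsParking (labelSlot t)
  labelSlot-parking = slot-parking (word t) (ballot-word t) length-word ∈-word

labelSlot-injective : ∀ {n} {t t′ : BTree (Fin n)} → IsLabeledBTNoRA n t → IsLabeledBTNoRA n t′ →
  (∀ x → labelSlot t x ≡ labelSlot t′ x) → t ≡ t′
labelSlot-injective {t = t} {t′} v v′ slots = word-injective
  (⊑-antisym (trans (length-word v) (sym (length-word v′))) (word-wellFormed v) (word-wellFormed v′)
    (λ {x} _ → ∈-word v′ x , slots x) (λ {x} _ → ∈-word v x , sym (slots x)))

-- Both sets coded by parking functions

pairCode : ∀ {n} → StPairs n → Fin n → ℕ
pairCode ((π₁ , π₂) , _) = code (descent π₂) (descent π₁)

pairCode-parking : ∀ {n} (p : StPairs n) → IsParking (pairCode p)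
-- The realizing filling is only irrelevantly available; a decidable inequality can still be
-- recomputed from it.
pairCode-parking ((π₁ , π₂) , irr p) le = recompute (_ ≤? _)
  (code-parking {pos = descent π₁} (descent-ranking π₂ (proj₁ (proj₂ (proj₂ p)))) le)

realizable-injective : ∀ {n} (π₁ π₂ ρ₁ ρ₂ : Vec (Fin n) n) → Realizable π₁ π₂ → Realizable ρ₁ ρ₂ →
  code (descent π₂) (descent π₁) ≗ code (descent ρ₂) (descent ρ₁) → (π₁ , π₂) ≡ (ρ₁ , ρ₂)
realizable-injective π₁ π₂ ρ₁ ρ₂
  p@(_ , (perm-π₁ , _) , (perm-π₂ , _)) q@(_ , (perm-ρ₁ , _) , (perm-ρ₂ , _)) codes =
  let tm≡ , pos≡ = code-injective (descent-ranking π₂ perm-π₂) (descent-ranking ρ₂ perm-ρ₂)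
        (descent-ranking π₁ perm-π₁) (descent-ranking ρ₁ perm-ρ₁)
        (realizable⇒compatible π₁ π₂ p) (realizable⇒compatible ρ₁ ρ₂ q) codes
  in cong₂ _,_ (descent-injective π₁ ρ₁ pos≡) (descent-injective π₂ ρ₂ tm≡)

stPairs-≡ : ∀ {n} {p q : StPairs n} → proj₁ p ≡ proj₁ q → p ≡ q
stPairs-≡ refl = refl

_≟V_ : ∀ {n} → DecidableEquality (Vec (Fin n) n × Vec (Fin n) n)
_≟V_ = Product.≡-dec (Vec.≡-dec Fin._≟_) (Vec.≡-dec Fin._≟_)

pairCode-injective : ∀ {n} (p q : StPairs n) → pairCode p ≗ pairCode q → p ≡ q
pairCode-injective ((π₁ , π₂) , irr p) ((ρ₁ , ρ₂) , irr q) codes = stPairs-≡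
  (recompute ((π₁ , π₂) ≟V (ρ₁ , ρ₂)) (realizable-injective π₁ π₂ ρ₁ ρ₂ p q codes))

pairCode-surjective : ∀ {n} (f : Fin n → ℕ) → IsParking f → ∃ λ (p : StPairs n) → pairCode p ≗ f
pairCode-surjective f pf with code-surjective f pf
... | tm , pos , rt , rp , compatible , codes with descent-surjective rt | descent-surjective rp
...   | π₂ , eqs₂ | π₁ , eqs₁ =
  ((π₁ , π₂) , irr (Realize.realizable tm pos rt rp compatible π₁ π₂ eqs₁ eqs₂)) , λ i →
    trans (count-cong (below? (descent π₂) (descent π₁) i) (below? tm pos i)
      (λ m (p , q) → subst₂ _<_ (eqs₂ m) (eqs₂ i) p , subst₂ _<_ (eqs₁ m) (eqs₁ i) q)
      (λ m (p , q) → subst₂ _<_ (sym (eqs₂ m)) (sym (eqs₂ i)) p ,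
                     subst₂ _<_ (sym (eqs₁ m)) (sym (eqs₁ i)) q))
    (codes i)

-- Decidable equality lets injectivity draw on the irrelevant validity proofs. Since words determine
-- trees, it is enough to compare words.
_≟T_ : ∀ {n} → DecidableEquality (BTree (Fin n))
t ≟T t′ = map′ word-injective (cong word) (List.≡-dec (List.≡-dec Fin._≟_) (word t) (word t′))

treeCode : ∀ {n} → LabeledBTNoRightAscent n → Fin n → ℕ
treeCode (t , _) = labelSlot t

treeCode-parking : ∀ {n} (t : LabeledBTNoRightAscent n) → IsParking (treeCode t)
treeCode-parking (t , irr valid) le = recompute (_ ≤? _) (labelSlot-parking valid le)

labeledBT-≡ : ∀ {n} {t u : LabeledBTNoRightAscent n} → proj₁ t ≡ proj₁ u → t ≡ u
labeledBT-≡ refl = refl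

treeCode-injective : ∀ {n} (t u : LabeledBTNoRightAscent n) → treeCode t ≗ treeCode u → t ≡ u
treeCode-injective (t , irr v) (u , irr w) codes =
  labeledBT-≡ {t = t , irr v} {u , irr w} (recompute (t ≟T u)
    (labelSlot-injective {t = t} {u} v w λ x → codes x))

treeCode-surjective : ∀ {n} (f : Fin n → ℕ) → IsParking f →
  ∃ λ (t : LabeledBTNoRightAscent n) → treeCode t ≗ f
treeCode-surjective {n} f pf
  with word-surjective (blocks f 0 (suc n)) (blocks-ballot f pf 0 (suc n) refl)
         (trans (cong suc (total-all f pf)) (sym (length-blocks f 0 (suc n))))
... | t , eq = (t , irr valid) , λ x → trans (cong (slot x) eq) (proj₂ (∈-blocks f pf x))
  where
  wf : WellFormed (word t)
  wf = subst WellFormed (sym eq) (blocks-wellFormed f 0 (suc n))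
  valid : IsLabeledBTNoRA n t
  valid = record
    { sizeN    = trans (sym (total-word t)) (trans (cong total eq) (total-all f pf))
    ; distinct = unique⇒distinct t (unique-resp-↭ (word↭labels t) (WellFormed.unique wf))
    ; noRA     = descending⇒noRA t (WellFormed.descending wf) }

theorem4p9 : (n : ℕ) → 1 ≤ n →
    (StPairs n ↔ LabeledBTNoRightAscent n) × (StPairs n ↔ Fin (suc n ^ (n ∸ 1)))
-- Both bijections factor through the parking function, so a pair corresponds to the tree with the
-- same parking function.
theorem4p9 (suc n) _ = (↔-sym trees ↔-∘ pairs) , pairs
  where
  pairs : StPairs (suc n) ↔ Fin (suc (suc n) ^ n)
  pairs = parking-coded pairCode pairCode-parking pairCode-injective pairCode-surjective
  trees : LabeledBTNoRightAscent (suc n) ↔ Fin (suc (suc n) ^ n)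
  trees = parking-coded treeCode treeCode-parking treeCode-injective treeCode-surjective
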